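{- For $|q|<1$, \[ \sum_{n=1}^{\infty} \overline{\mathrm{spt}}_{\omega}(n)q^n =\frac{(-q^2;q^2)_{\infty}}{(q^2;q^2)_{\infty}} \sum_{n=1}^{\infty} \frac{nq^{n}}{1-q^n} +2 \frac{(-q^2;q^2)_{\infty} }{(q^2;q^2)_{\infty}} \sum_{n=1}^{\infty} \frac{(-1)^n q^{2n(n+1)}}{(1-q^{2n})^2}. \]
   Context: $(a;q)_n=\prod_{k=0}^{n-1}(1-aq^k)$, $(a;q)_\infty=\prod_{k\ge0}(1-aq^k)$. $\overline{\mathrm{spt}}_{\omega}(n)$ is the number of smallest parts in the overpartitions of $n$ in which the smallest part is overlined and all odd parts are less than twice the smallest part; equivalently $\sum_{n\ge1}\overline{\mathrm{spt}}_{\omega}(n)q^n=\sum_{n\ge1}\frac{q^{n}(-q^{n+1};q)_{n}(-q^{2n+2};q^2)_{\infty}}{(1-q^n)^2(q^{n+1};q)_n(q^{2n+2};q^2)_{\infty}}$. -}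

module Defs where

open import Data.Nat as ℕ using (ℕ; zero; suc; _∸_; _≡ᵇ_)
open import Data.Nat.Divisibility using (_∣?_)
open import Data.Integer using (ℤ; +_; -_; _+_; _*_)
open import Data.Bool using (if_then_else_)
open import Relation.Nullary.Decidable using (⌊_⌋)

-- Formal power series in q with integer coefficients: coefficient sequences.
PS : Set
PS = ℕ → ℤ

sumTo : ℕ → (ℕ → ℤ) → ℤ
sumTo zero    h = h 0
sumTo (suc n) h = sumTo n h + h (suc n)

infixl 6 _⊕_
infixl 7 _⊛_

_⊕_ : PS → PS → PS
(f ⊕ g) N = f N + g N

_⊛_ : PS → PS → PS
(f ⊛ g) N = sumTo N (λ i → f i * g (N ∸ i))

scale : ℤ → PS → PS
scale c f N = c * f N

one : PS
one N = if N ≡ᵇ 0 then + 1 else + 0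

mono : ℕ → PS
mono k N = if k ≡ᵇ N then + 1 else + 0

-- 1/(1 - q^k) = Σ_{j≥0} q^{kj}   (only used with k ≥ 1)
geom : ℕ → PS
geom k N = if ⌊ k ∣? N ⌋ then + 1 else + 0

prodUpTo : ℕ → (ℕ → PS) → PS
prodUpTo zero    f = one
prodUpTo (suc n) f = prodUpTo n f ⊛ f n

-- infinite product ∏_{k≥0} f k, for factors with f k ≡ 1 (mod q^{k+1})
-- (always the case below): the coefficient of q^N only depends on the
-- factors with k ≤ N.
prodInf : (ℕ → PS) → PS
prodInf f N = prodUpTo (suc N) f N

-- infinite sum Σ_{n≥1} g n, for summands g n of order ≥ n (always the case
-- below): the coefficient of q^N only depends on the summands with n ≤ N+1.
sumInf1 : (ℕ → PS) → PS
sumInf1 g N = sumTo N (λ n → g (suc n) N)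

sgn : ℕ → ℤ
sgn zero    = + 1
sgn (suc n) = - sgn n

negPochInf : ℕ → ℕ → PS
negPochInf a b = prodInf (λ k → one ⊕ mono (a ℕ.+ b ℕ.* k))

invPochInf : ℕ → ℕ → PS
invPochInf a b = prodInf (λ k → geom (a ℕ.+ b ℕ.* k))

negPoch : ℕ → ℕ → PS
negPoch a n = prodUpTo n (λ k → one ⊕ mono (a ℕ.+ k))

invPoch : ℕ → ℕ → PS
invPoch a n = prodUpTo n (λ k → geom (a ℕ.+ k))

-- n-th summand of the generating function of spt-bar_ω:
-- q^n (-q^{n+1};q)_n (-q^{2n+2};q^2)_∞ / ((1-q^n)^2 (q^{n+1};q)_n (q^{2n+2};q^2)_∞)
sptTerm : ℕ → PS
sptTerm n = mono n ⊛ negPoch (suc n) n ⊛ negPochInf (2 ℕ.* n ℕ.+ 2) 2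
            ⊛ geom n ⊛ geom n ⊛ invPoch (suc n) n ⊛ invPochInf (2 ℕ.* n ℕ.+ 2) 2

-- Σ_{n≥1} spt-bar_ω(n) q^n  (so sptω N is spt-bar_ω(N) for N ≥ 1, and 0 for N = 0)
sptω : PS
sptω = sumInf1 sptTerm

A : PS
A = negPochInf 2 2 ⊛ invPochInf 2 2

S1 : PS
S1 = sumInf1 (λ n → scale (+ n) (mono n ⊛ geom n))

S2 : PS
S2 = sumInf1 (λ n → scale (sgn n) (mono (2 ℕ.* n ℕ.* suc n) ⊛ geom (2 ℕ.* n) ⊛ geom (2 ℕ.* n)))

RHS : PS
RHS = A ⊛ S1 ⊕ scale (+ 2) (A ⊛ S2)

{-# OPTIONS --safe #-}

-- Dividing the n-th summand by A = (-q²;q²)_∞/(q²;q²)_∞ leaves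
--   q^n (q)_{n-1}² β_n,   β_n = (-q;q²)_n/(q)_{2n},
-- and β_n = Σ_{r≥0} α_r/((q)_{n-2r}(q)_{n+2r}) with α_0 = 1 and α_r = 2(-1)^r q^{2r²}, because the
-- recurrence in n that q-Pascal gives for the right-hand side telescopes in r.  Interchanging the
-- sums leaves X_r = Σ_{n≥1} q^n (q)_{n-1}²/((q)_{n-r}(q)_{n+r}), for which creative telescoping
-- yields X_r = q^r/(1-q^r)² when r ≥ 1, while X_0 = Σ q^n/(1-q^n)² = Σ n q^n/(1-q^n).
-- All of this is done in a commutative ring in which a power of q vanishes; power series modulo
-- q^{N+1} form such a ring, so every infinite sum and product there is finite.
module Submission where

open import Defs
open import Algebra.Bundles using (CommutativeRing)
import Algebra.Solver.Ring
open import Algebra.Solver.Ring.AlmostCommutativeRing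
  using (_-Raw-AlmostCommutative⟶_; fromCommutativeRing)
open import Data.Integer as ℤ using (ℤ; +_)
import Data.Integer.Properties as ℤₚ
open import Data.Maybe as Maybe using (Maybe)
open import Data.Nat as ℕ using (ℕ; zero; suc; _∸_; _<_; _≤_; _≥_; s≤s; z≤n)
open import Data.Nat.Divisibility using (_∣?_; ∣m+n∣m⇒∣n; ∣m∣n⇒∣m+n; ∣-refl; ∣⇒≤; _∣0)
import Data.Nat.Properties as ℕₚ
open import Data.Nat.Solver using (module +-*-Solver)
open import Data.Product using (_,_)
open import Relation.Binary.PropositionalEquality as ≡ using (_≡_)
open import Relation.Nullary using (yes; no; contradiction)
open import Relation.Nullary.Decidable using (dec⇒maybe)
open +-*-Solver using ()
  renaming (solve to ℕ-solve; con to ncon; _:+_ to infixl 7 _:⊹:_; _:*_ to infixl 8 _:×:_; _:=_ to infix 4 _:≡:_)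

-- The sums `X r` are the γ of the conjugate Bailey pair with δ_n = q^n (q)_{n-1}²: Bailey's lemma
-- at a = 1 with both parameters tending to 1, divided by the factors 1 - ρ that vanish in the
-- limit. That limit is singular at r = 0, which is why X_0 is a Lambert series while every other
-- X_r is a rational function. In the Bailey pair only the even columns 2r carry a nonzero α.
--
-- The ring has no division; the elements 1/(1 - q^k) enter only through `inv`. Quotients of
-- q-factorials are therefore compared over a common reciprocal, which leaves polynomial identities
-- in q, q^n, q^j and q^{n-j}. With truncated subtraction the relation q^n = q^j q^{n-j} fails for j
-- > n. It is used only after multiplication by 1/(q)_{n-j}, which is 0 in that case, so the
-- recurrences hold for all n and j without a case distinction.

dbl : ℕ → ℕ
dbl zero    = zero
dbl (suc n) = suc (suc (dbl n))

-- `dbl (suc r)` unfolds to two constructors, so `ipd` and `ip` compute on it, which `2 * suc r`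
-- does not allow; this equation converts back where exponents are written with `2 *`.
dbl≡ : ∀ n → dbl n ≡ 2 ℕ.* n
dbl≡ zero    = ≡.refl
dbl≡ (suc n) = ≡.trans (≡.cong (λ m → suc (suc m)) (dbl≡ n)) (≡.sym (ℕₚ.*-suc 2 n))

n≤dbl : ∀ n → n ≤ dbl n
n≤dbl zero    = z≤n
n≤dbl (suc n) = ℕₚ.m≤n⇒m≤1+n (s≤s (n≤dbl n))

module FiniteSums {c ℓ} (R : CommutativeRing c ℓ)
  (hom : ℤ.+-*-rawRing -Raw-AlmostCommutative⟶ fromCommutativeRing R) where

  open CommutativeRing R hiding (zero)
  open _-Raw-AlmostCommutative⟶_ hom public
    renaming (⟦_⟧ to ι; +-homo to ι-+; *-homo to ι-*; -‿homo to ι-neg; 0-homo to ι-0; 1-homo to ι-1)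
  open import Algebra.Properties.Ring ring using (-0#≈0#)
  open import Relation.Binary.Reasoning.Setoid setoid

  ι≟ : ∀ i j → Maybe (ι i ≈ ι j)
  ι≟ i j = Maybe.map (λ i≡j → reflexive (≡.cong ι i≡j)) (dec⇒maybe (i ℤ.≟ j))

  module Solver = Algebra.Solver.Ring ℤ.+-*-rawRing (fromCommutativeRing R) hom ι≟
  open Solver using (solve; _:=_; _:+_; _:*_; _:-_; con; Polynomial; _:^_)

  -- `con (+ 1)` denotes `ι (+ 1)`, which is not definitionally `1#`; a zeroth power is.
  :1 : ∀ {n} → Polynomial n
  :1 = con (+ 0) :^ 0

  -- Finite sums and products in a commutative ring.

  Σ< : ℕ → (ℕ → Carrier) → Carrier
  Σ< zero    f = 0#
  Σ< (suc n) f = Σ< n f + f n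

  ∏< : ℕ → (ℕ → Carrier) → Carrier
  ∏< zero    f = 1#
  ∏< (suc n) f = ∏< n f * f n

  Σ-cong< : ∀ n {f g} → (∀ i → i < n → f i ≈ g i) → Σ< n f ≈ Σ< n g
  Σ-cong< zero    e = refl
  Σ-cong< (suc n) e = +-cong (Σ-cong< n (λ i i<n → e i (ℕₚ.m<n⇒m<1+n i<n))) (e n ℕₚ.≤-refl)

  Σ-cong : ∀ n {f g} → (∀ i → f i ≈ g i) → Σ< n f ≈ Σ< n g
  Σ-cong n e = Σ-cong< n (λ i _ → e i)

  *-Σ : ∀ n x f → x * Σ< n f ≈ Σ< n (λ i → x * f i)
  *-Σ zero    x f = zeroʳ x
  *-Σ (suc n) x f = trans (distribˡ x _ _) (+-congʳ (*-Σ n x f))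

  Σ-0 : ∀ n {f : ℕ → Carrier} → (∀ i → f i ≈ 0#) → Σ< n f ≈ 0#
  Σ-0 zero    e = refl
  Σ-0 (suc n) e = trans (+-cong (Σ-0 n e) (e n)) (+-identityˡ 0#)

  Σ-+ : ∀ n f g → Σ< n (λ i → f i + g i) ≈ Σ< n f + Σ< n g
  Σ-+ zero    f g = sym (+-identityˡ 0#)
  Σ-+ (suc n) f g = trans (+-congʳ (Σ-+ n f g))
    (solve 4 (λ a b c d → (a :+ b) :+ (c :+ d) := (a :+ c) :+ (b :+ d)) refl _ _ _ _)

  Σ-swap : ∀ m n (f : ℕ → ℕ → Carrier) →
    Σ< m (λ i → Σ< n (f i)) ≈ Σ< n (λ j → Σ< m (λ i → f i j))
  Σ-swap zero    n f = sym (Σ-0 n (λ _ → refl))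
  Σ-swap (suc m) n f = trans (+-congʳ (Σ-swap m n f)) (sym (Σ-+ n _ _))

  Σ-head : ∀ n f → Σ< (suc n) f ≈ f 0 + Σ< n (λ i → f (suc i))
  Σ-head zero    f = +-comm _ _
  Σ-head (suc n) f = trans (+-congʳ (Σ-head n f)) (+-assoc _ _ _)

  Σ-telescope : ∀ n (f : ℕ → Carrier) → Σ< n (λ i → f i - f (suc i)) ≈ f 0 - f n
  Σ-telescope zero    f = sym (-‿inverseʳ (f 0))
  Σ-telescope (suc n) f = trans (+-congʳ (Σ-telescope n f))
    (solve 3 (λ a b c → (a :- b) :+ (b :- c) := a :- c) refl _ _ _)

  ∏-cong : ∀ n {f g} → (∀ i → f i ≈ g i) → ∏< n f ≈ ∏< n g
  ∏-cong zero    e = refl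
  ∏-cong (suc n) e = *-cong (∏-cong n e) (e n)

  ∏-1 : ∀ n {f : ℕ → Carrier} → (∀ i → f i ≈ 1#) → ∏< n f ≈ 1#
  ∏-1 zero    e = refl
  ∏-1 (suc n) e = trans (*-cong (∏-1 n e) (e n)) (*-identityˡ 1#)

  ∏-* : ∀ n f g → ∏< n (λ i → f i * g i) ≈ ∏< n f * ∏< n g
  ∏-* zero    f g = sym (*-identityˡ 1#)
  ∏-* (suc n) f g = trans (*-congʳ (∏-* n f g))
    (solve 4 (λ a b c d → (a :* b) :* (c :* d) := (a :* c) :* (b :* d)) refl _ _ _ _)

  ∏-split : ∀ m n f → ∏< (n ℕ.+ m) f ≈ ∏< m f * ∏< n (λ k → f (k ℕ.+ m))
  ∏-split m zero    f = sym (*-identityʳ _)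
  ∏-split m (suc n) f = trans (*-congʳ (∏-split m n f)) (*-assoc _ _ _)

  -- The finite form of splitting an infinite product after n factors: both sides equal the product
  -- of the first `K + n` factors, so n may exceed K.
  ∏-shift : ∀ K n {f : ℕ → Carrier} → (∀ k → f (k ℕ.+ K) ≈ 1#) →
    ∏< n f * ∏< K (λ k → f (k ℕ.+ n)) ≈ ∏< K f
  ∏-shift K n {f} f≈1 = begin
    ∏< n f * ∏< K (λ k → f (k ℕ.+ n))  ≈⟨ ∏-split n K f ⟨
    ∏< (K ℕ.+ n) f                     ≡⟨ ≡.cong (λ m → ∏< m f) (ℕₚ.+-comm K n) ⟩
    ∏< (n ℕ.+ K) f                     ≈⟨ ∏-split K n f ⟩
    ∏< K f * ∏< n (λ k → f (k ℕ.+ K))  ≈⟨ *-congˡ (∏-1 n f≈1) ⟩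
    ∏< K f * 1#                        ≈⟨ *-identityʳ _ ⟩
    ∏< K f                             ∎

  -- Powers of q and reciprocal q-factorials.

  module WithQ (Q : ℕ → Carrier) (Q-0 : Q 0 ≈ 1#) (Q-+ : ∀ m n → Q (m ℕ.+ n) ≈ Q m * Q n)
    (inv : ℕ → Carrier) (inv-spec : ∀ k → (1# - Q (suc k)) * inv (suc k) ≈ 1#) where

    q : Carrier
    q = Q 1

    minusʳ : ∀ {x y z} → y ≈ z → x - y ≈ x - z
    minusʳ e = +-congˡ (-‿cong e)

    minus-0 : ∀ {x y} → y ≈ 0# → x - y ≈ x
    minus-0 e = trans (minusʳ e) (trans (+-congˡ -0#≈0#) (+-identityʳ _))

    poch ip : ℕ → Carrier
    poch n = ∏< n (λ k → 1# - Q (suc k))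
    ip   n = ∏< n (λ k → inv (suc k))

    ip-step : ∀ n → ip n ≈ (1# - Q (suc n)) * ip (suc n)
    ip-step n = begin
      ip n                                            ≈⟨ *-identityʳ _ ⟨
      ip n * 1#                                       ≈⟨ *-congˡ (inv-spec n) ⟨
      ip n * ((1# - Q (suc n)) * inv (suc n))         ≈⟨ solve 3 (λ a b c → a :* (b :* c) := b :* (a :* c)) refl _ _ _ ⟩
      (1# - Q (suc n)) * (ip n * inv (suc n))         ∎

    -- 1/(q)_{n-j}, with the usual convention 1/(q)_{-k} = 0 for k > 0.
    ipd : ℕ → ℕ → Carrier
    ipd n       zero    = ip n
    ipd zero    (suc j) = 0#
    ipd (suc n) (suc j) = ipd n j

    -- Truncated subtraction gives the right value at the edge: for j = n the factor is 1 - q^0 = 0,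
    -- and for j > n both sides carry a vanishing reciprocal.
    ipd-step : ∀ n j → ipd n (suc j) ≈ (1# - Q (n ∸ j)) * ipd n j
    ipd-step zero zero = sym (begin
      (1# - Q 0) * 1#  ≈⟨ *-congʳ (trans (minusʳ Q-0) (-‿inverseʳ 1#)) ⟩
      0# * 1#          ≈⟨ zeroˡ _ ⟩
      0#               ∎)
    ipd-step (suc n) zero    = ip-step n
    ipd-step zero    (suc j) = sym (zeroʳ _)
    ipd-step (suc n) (suc j) = ipd-step n j

    ipd-Q : ∀ n j → Q n * ipd n j ≈ Q j * Q (n ∸ j) * ipd n j
    ipd-Q n       zero    = *-congʳ (sym (trans (*-congʳ Q-0) (*-identityˡ _)))
    ipd-Q zero    (suc j) = trans (zeroʳ _) (sym (zeroʳ _))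
    ipd-Q (suc n) (suc j) = begin
      Q (suc n) * ipd n j                ≈⟨ *-congʳ (Q-+ 1 n) ⟩
      q * Q n * ipd n j                  ≈⟨ *-assoc _ _ _ ⟩
      q * (Q n * ipd n j)                ≈⟨ *-congˡ (ipd-Q n j) ⟩
      q * (Q j * Q (n ∸ j) * ipd n j)    ≈⟨ solve 4 (λ a b c d → a :* (b :* c :* d) := a :* b :* c :* d) refl _ _ _ _ ⟩
      q * Q j * Q (n ∸ j) * ipd n j      ≈⟨ *-congʳ (*-congʳ (Q-+ 1 j)) ⟨
      Q (suc j) * Q (n ∸ j) * ipd n j    ∎

    ipd-Q-suc : ∀ n j → q * Q (n ∸ suc j) * ipd n (suc j) ≈ Q (n ∸ j) * ipd n (suc j)
    ipd-Q-suc zero    j       = trans (zeroʳ _) (sym (zeroʳ _))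
    ipd-Q-suc (suc n) zero    = *-congʳ (sym (Q-+ 1 n))
    ipd-Q-suc (suc n) (suc j) = ipd-Q-suc n j

    -- The factor q turns 1 - q^{n-j-1} into q - q^{n-j}, so that q^{n-j} is the only difference
    -- power left in the polynomial identities.
    ipd-step₂ : ∀ n j → q * ipd n (suc (suc j)) ≈ (q - Q (n ∸ j)) * ((1# - Q (n ∸ j)) * ipd n j)
    ipd-step₂ n j = begin
      q * ipd n (suc (suc j))                                ≈⟨ *-congˡ (ipd-step n (suc j)) ⟩
      q * ((1# - Q (n ∸ suc j)) * ipd n (suc j))             ≈⟨ solve 3 (λ a b c → a :* ((:1 :- b) :* c) := a :* c :- a :* b :* c) refl _ _ _ ⟩
      q * ipd n (suc j) - q * Q (n ∸ suc j) * ipd n (suc j)  ≈⟨ minusʳ (ipd-Q-suc n j) ⟩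
      q * ipd n (suc j) - Q (n ∸ j) * ipd n (suc j)          ≈⟨ solve 3 (λ a b c → a :* c :- b :* c := (a :- b) :* c) refl _ _ _ ⟩
      (q - Q (n ∸ j)) * ipd n (suc j)                        ≈⟨ *-congˡ (ipd-step n j) ⟩
      (q - Q (n ∸ j)) * ((1# - Q (n ∸ j)) * ipd n j)         ∎

    ipd-vanish : ∀ n j → n < j → ipd n j ≈ 0#
    ipd-vanish zero    (suc j) _         = refl
    ipd-vanish (suc n) (suc j) (s≤s n<j) = ipd-vanish n j n<j

    -- The q-Pascal recurrence for 1/((q)_{n-j}(q)_{n+j}).

    e : ℕ → ℕ → Carrier
    e n j = ipd n j * ip (j ℕ.+ n)

    Q-suc-+ : ∀ m n → Q (suc (m ℕ.+ n)) ≈ q * (Q m * Q n)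
    Q-suc-+ m n = trans (Q-+ 1 _) (*-congˡ (Q-+ m n))

    Q-suc-suc-+ : ∀ m n → Q (suc (suc (m ℕ.+ n))) ≈ q * (q * (Q m * Q n))
    Q-suc-suc-+ m n = trans (Q-+ 1 _) (*-congˡ (Q-suc-+ m n))

    -- The ratio (q)_{2n+2}/(q)_{2n}. Since `e n j` is the q-binomial coefficient [2n, n-j] divided
    -- by (q)_{2n}, this factor turns q-Pascal into a recurrence for `e`.
    step₂ : ℕ → Carrier
    step₂ n = (1# - Q (suc (n ℕ.+ n))) * (1# - Q (suc (suc (n ℕ.+ n))))

    step₂-cong : ∀ n → step₂ n ≈ (1# - q * (Q n * Q n)) * (1# - q * (q * (Q n * Q n)))
    step₂-cong n = *-cong (minusʳ (Q-suc-+ n n)) (minusʳ (Q-suc-suc-+ n n))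

    -- q-Pascal applied twice to [2n+2, n-j], once in each of its two forms. The two paths that end
    -- in [2n, n-j-1] contribute 1 and q^{2n+1}.
    e-rec : ∀ n j → step₂ n * e (suc n) (suc j)
      ≈ Q (n ∸ j) * e n j + (1# + Q (suc (n ℕ.+ n))) * e n (suc j) + Q (suc (suc (j ℕ.+ n))) * e n (suc (suc j))
    e-rec n j = begin
      step₂ n * (J * ip (suc (j ℕ.+ suc n)))
        ≈⟨ *-cong (step₂-cong n) (*-congˡ (reflexive (≡.cong (λ i → ip (suc i)) (ℕₚ.+-suc j n)))) ⟩
      (1# - q * (N * N)) * (1# - q * (q * (N * N))) * (J * u)
        -- The last summand on the right is a multiple of `N * J - Y * x * J`, which is 0 by
        -- `ipd-Q`. Its cofactor is the quotient left when the two sides are compared as polynomials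
        -- without the relation q^n = q^j q^{n-j}.
        ≈⟨ solve 6 (λ q N Y x J u →
             (:1 :- q :* (N :* N)) :* (:1 :- q :* (q :* (N :* N))) :* (J :* u)
             := x :* (J :* ((:1 :- q :* (Y :* N)) :* ((:1 :- q :* (q :* (Y :* N))) :* u)))
                :+ (:1 :+ q :* (N :* N)) :* ((:1 :- x) :* J :* ((:1 :- q :* (q :* (Y :* N))) :* u))
                :+ q :* (Y :* N) :* ((q :- x) :* ((:1 :- x) :* J)) :* u
                :+ (q :* q :* q :* N :* N :* (N :+ Y) :- con (+ 2) :* q :* N :- q :* q :* N :+ q :* N :* x) :* u :* (N :* J :- Y :* x :* J))
             refl q N Y x J u ⟩
      _ ≈⟨ +-cong (+-cong (+-cong
             (*-congˡ (*-congˡ (trans (*-cong (minusʳ (sym (Q-suc-+ j n))) (sym u₁)) (sym (ip-step (j ℕ.+ n))))))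
             (*-cong (+-congˡ (sym (Q-suc-+ n n))) (*-cong (sym (ipd-step n j)) (sym u₁))))
             (*-congʳ (*-congˡ (sym (ipd-step₂ n j)))))
             (trans (*-congˡ (trans (+-congʳ (ipd-Q n j)) (-‿inverseʳ _))) (zeroʳ _)) ⟩
      x * e n j + (1# + Q (suc (n ℕ.+ n))) * e n (suc j) + q * (Y * N) * (q * ipd n (suc (suc j))) * u + 0#
        ≈⟨ +-identityʳ _ ⟩
      x * e n j + (1# + Q (suc (n ℕ.+ n))) * e n (suc j) + q * (Y * N) * (q * ipd n (suc (suc j))) * u
        ≈⟨ solve 7 (λ a b q Y N i u → a :+ b :+ q :* (Y :* N) :* (q :* i) :* u := a :+ b :+ q :* (q :* (Y :* N)) :* (i :* u)) refl _ _ q Y N _ u ⟩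
      x * e n j + (1# + Q (suc (n ℕ.+ n))) * e n (suc j) + q * (q * (Y * N)) * (ipd n (suc (suc j)) * u)
        ≈⟨ +-congˡ (*-congʳ (Q-suc-suc-+ j n)) ⟨
      x * e n j + (1# + Q (suc (n ℕ.+ n))) * e n (suc j) + Q (suc (suc (j ℕ.+ n))) * e n (suc (suc j)) ∎
      where
      N Y x J u : Carrier
      N = Q n
      Y = Q j
      x = Q (n ∸ j)
      J = ipd n j
      u = ip (suc (suc (j ℕ.+ n)))
      u₁ : ip (suc (j ℕ.+ n)) ≈ (1# - q * (q * (Y * N))) * u
      u₁ = trans (ip-step (suc (j ℕ.+ n))) (*-congʳ (minusʳ (Q-suc-suc-+ j n)))

    -- `e-rec` continued to j = -1 and folded by the symmetry of 1/((q)_{n-j}(q)_{n+j}) under j ↦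
    -- -j: the two outer terms coincide, hence the factor 2.
    e-rec₀ : ∀ n → step₂ n * e (suc n) 0 ≈ (1# + Q (suc (n ℕ.+ n))) * e n 0 + ι (+ 2) * (Q (suc n) * e n 1)
    e-rec₀ n = begin
      step₂ n * (u * u)
        ≈⟨ *-congʳ (step₂-cong n) ⟩
      (1# - q * (N * N)) * (1# - q * (q * (N * N))) * (u * u)
        ≈⟨ solve 3 (λ q N u →
             (:1 :- q :* (N :* N)) :* (:1 :- q :* (q :* (N :* N))) :* (u :* u)
             := (:1 :+ q :* (N :* N)) :* ((:1 :- q :* N) :* u :* ((:1 :- q :* N) :* u))
                :+ con (+ 2) :* (q :* N :* ((:1 :- N) :* ((:1 :- q :* N) :* u) :* u)))
             refl q N u ⟩
      (1# + q * (N * N)) * ((1# - q * N) * u * ((1# - q * N) * u)) + ι (+ 2) * (q * N * ((1# - N) * ((1# - q * N) * u) * u))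
        ≈⟨ +-cong (*-cong (+-congˡ (Q-suc-+ n n)) (*-cong ip-n ip-n))
             (*-congˡ (*-cong (Q-+ 1 n) (*-congʳ (trans (ipd-step n 0) (*-congˡ ip-n))))) ⟨
      (1# + Q (suc (n ℕ.+ n))) * (ip n * ip n) + ι (+ 2) * (Q (suc n) * (ipd n 1 * u)) ∎
      where
      N u : Carrier
      N = Q n
      u = ip (suc n)
      ip-n : ip n ≈ (1# - q * N) * u
      ip-n = trans (ip-step n) (*-congʳ (minusʳ (Q-+ 1 n)))

    -- The Bailey pair.

    Q-cong : ∀ {m n} → m ≡ n → Q m ≈ Q n
    Q-cong m≡n = reflexive (≡.cong Q m≡n)

    W : ℕ → Carrier
    W r = Q (2 ℕ.* r ℕ.* suc r)

    -- The exponent is split so that q^{2r+1} stands ready for `ipd-Q` in column 2r+1.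
    Q-2[r+1]² : ∀ r → Q (2 ℕ.* (suc r ℕ.* suc r)) ≈ q * (W r * Q (suc (dbl r)))
    Q-2[r+1]² r = trans (Q-cong exponent) (Q-suc-+ _ (suc (dbl r)))
      where
      exponent : 2 ℕ.* (suc r ℕ.* suc r) ≡ suc (2 ℕ.* r ℕ.* suc r ℕ.+ suc (dbl r))
      exponent rewrite dbl≡ r = identity r
        where
        identity : ∀ r → 2 ℕ.* (suc r ℕ.* suc r) ≡ suc (2 ℕ.* r ℕ.* suc r ℕ.+ suc (2 ℕ.* r))
        identity = ℕ-solve 1 (λ r → ncon 2 :×: ((ncon 1 :⊹: r) :×: (ncon 1 :⊹: r))
          :≡: ncon 1 :⊹: (ncon 2 :×: r :×: (ncon 1 :⊹: r) :⊹: (ncon 1 :⊹: ncon 2 :×: r))) ≡.refl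

    Q-2[r+1]²-+ : ∀ r n → Q (2 ℕ.* (suc r ℕ.* suc r)) * Q (suc (suc (suc (dbl r) ℕ.+ n))) ≈ q * (W (suc r) * Q n)
    Q-2[r+1]²-+ r n = trans (sym (Q-+ _ _)) (trans (Q-cong exponent) (Q-suc-+ _ n))
      where
      exponent : 2 ℕ.* (suc r ℕ.* suc r) ℕ.+ suc (suc (suc (dbl r) ℕ.+ n)) ≡ suc (2 ℕ.* suc r ℕ.* suc (suc r) ℕ.+ n)
      exponent rewrite dbl≡ r = identity r n
        where
        identity : ∀ r n → 2 ℕ.* (suc r ℕ.* suc r) ℕ.+ suc (suc (suc (2 ℕ.* r) ℕ.+ n)) ≡ suc (2 ℕ.* suc r ℕ.* suc (suc r) ℕ.+ n)
        identity = ℕ-solve 2 (λ r n → ncon 2 :×: ((ncon 1 :⊹: r) :×: (ncon 1 :⊹: r)) :⊹: (ncon 3 :⊹: (ncon 2 :×: r :⊹: n))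
          :≡: ncon 1 :⊹: (ncon 2 :×: (ncon 1 :⊹: r) :×: (ncon 2 :⊹: r) :⊹: n)) ≡.refl

    α : ℕ → Carrier
    α zero    = 1#
    α (suc r) = ι (+ 2) * (ι (sgn (suc r)) * Q (2 ℕ.* (suc r ℕ.* suc r)))

    -- The certificate by which the recurrence for Σ α_r e(n,2r) telescopes.
    H : ℕ → ℕ → Carrier
    H n r = ι (+ 2) * (ι (sgn r) * (q * (W r * Q n) * e n (suc (dbl r))))

    -- The outer terms of `e-rec` lie in the odd columns 2r+1 and 2r+3. There the exponents 2(r+1)²
    -- + (n-2r-1) and 2(r+1)² + (n+2r+3) equal 1 + n + 2r(r+1) and 1 + n + 2(r+1)(r+2), which are
    -- consecutive values of one function of r. With the alternating sign, neighbouring values of r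
    -- thus cancel in their common column.
    α-rec : ∀ n r → α (suc r) * (step₂ n * e (suc n) (dbl (suc r)))
      ≈ (1# + Q (suc (n ℕ.+ n))) * (α (suc r) * e n (dbl (suc r))) + (H n (suc r) - H n r)
    α-rec n r = begin
      two * (s′ * T) * (step₂ n * e (suc n) (dbl (suc r)))
        ≈⟨ *-congˡ (e-rec n (suc (dbl r))) ⟩
      two * (s′ * T) * (x * (J * u) + D * F + Q (suc (suc (suc (dbl r) ℕ.+ n))) * G)
        ≈⟨ solve 9 (λ two s′ T x J u DF Z G →
             two :* (s′ :* T) :* (x :* (J :* u) :+ DF :+ Z :* G)
             := two :* s′ :* u :* (T :* (x :* J)) :+ (two :* (s′ :* T) :* DF :+ two :* (s′ :* (T :* Z :* G))))
           refl two s′ T x J u (D * F) _ G ⟩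
      two * s′ * u * (T * (x * J)) + (two * (s′ * T) * (D * F) + two * (s′ * (T * Q (suc (suc (suc (dbl r) ℕ.+ n))) * G)))
        ≈⟨ +-cong (*-cong (*-congʳ (*-congˡ (ι-neg (sgn r)))) TxJ) (+-congˡ (*-congˡ (*-congˡ (*-congʳ (Q-2[r+1]²-+ r n))))) ⟩
      two * - s * u * (q * W r * (Q n * J)) + (two * (s′ * T) * (D * F) + H n (suc r))
        ≈⟨ solve 12 (λ two s u q W N J s′ T D F h →
             two :* (:- s) :* u :* (q :* W :* (N :* J)) :+ (two :* (s′ :* T) :* (D :* F) :+ h)
             := D :* (two :* (s′ :* T) :* F) :+ (h :- two :* (s :* (q :* (W :* N) :* (J :* u)))))
           refl two s u q (W r) (Q n) J s′ T D F _ ⟩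
      D * (two * (s′ * T) * F) + (H n (suc r) - H n r) ∎
      where
      open Solver using (:-_)
      two s s′ T x J u D F G : Carrier
      two = ι (+ 2)
      s = ι (sgn r)
      s′ = ι (sgn (suc r))
      T = Q (2 ℕ.* (suc r ℕ.* suc r))
      x = Q (n ∸ suc (dbl r))
      J = ipd n (suc (dbl r))
      u = ip (suc (dbl r) ℕ.+ n)
      D = 1# + Q (suc (n ℕ.+ n))
      F = e n (dbl (suc r))
      G = e n (suc (dbl (suc r)))
      TxJ : T * (x * J) ≈ q * W r * (Q n * J)
      TxJ = begin
        T * (x * J)                               ≈⟨ *-congʳ (Q-2[r+1]² r) ⟩
        q * (W r * Q (suc (dbl r))) * (x * J)     ≈⟨ solve 5 (λ q W Y x J → q :* (W :* Y) :* (x :* J) := q :* W :* (Y :* x :* J)) refl _ _ _ _ _ ⟩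
        q * W r * (Q (suc (dbl r)) * x * J)       ≈⟨ *-congˡ (ipd-Q n (suc (dbl r))) ⟨
        q * W r * (Q n * J)                       ∎

    B : ℕ → ℕ → Carrier
    B R n = Σ< R (λ r → α r * e n (dbl r))

    -- The doubled term of `e-rec₀` is exactly `H n 0`, so it cancels the lower end of the
    -- telescoping and only the upper boundary term survives.
    B-rec : ∀ R n → step₂ n * B (suc R) (suc n) ≈ (1# + Q (suc (n ℕ.+ n))) * B (suc R) n + H n R
    B-rec zero n = begin
      step₂ n * (0# + 1# * e (suc n) 0)
        ≈⟨ *-congˡ (trans (+-identityˡ _) (*-identityˡ _)) ⟩
      step₂ n * e (suc n) 0
        ≈⟨ e-rec₀ n ⟩
      (1# + Q (suc (n ℕ.+ n))) * e n 0 + ι (+ 2) * (Q (suc n) * e n 1)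
        ≈⟨ +-cong (*-congˡ (sym (trans (+-identityˡ _) (*-identityˡ _)))) (*-congˡ first) ⟩
      (1# + Q (suc (n ℕ.+ n))) * (0# + 1# * e n 0) + H n 0 ∎
      where
      first : Q (suc n) * e n 1 ≈ ι (+ 1) * (q * (Q 0 * Q n) * e n 1)
      first = begin
        Q (suc n) * e n 1                  ≈⟨ *-congʳ (Q-suc-+ 0 n) ⟩
        q * (Q 0 * Q n) * e n 1            ≈⟨ *-identityˡ _ ⟨
        1# * (q * (Q 0 * Q n) * e n 1)     ≈⟨ *-congʳ ι-1 ⟨
        ι (+ 1) * (q * (Q 0 * Q n) * e n 1)  ∎
    B-rec (suc R) n = begin
      step₂ n * (B (suc R) (suc n) + α (suc R) * e (suc n) (dbl (suc R)))
        ≈⟨ solve 4 (λ a b c d → a :* (b :+ c :* d) := a :* b :+ c :* (a :* d)) refl _ _ _ _ ⟩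
      step₂ n * B (suc R) (suc n) + α (suc R) * (step₂ n * e (suc n) (dbl (suc R)))
        ≈⟨ +-cong (B-rec R n) (α-rec n R) ⟩
      D * B (suc R) n + H n R + (D * (α (suc R) * e n (dbl (suc R))) + (H n (suc R) - H n R))
        ≈⟨ solve 5 (λ d b h k c → d :* b :+ h :+ (d :* c :+ (k :- h)) := d :* (b :+ c) :+ k) refl _ _ _ _ _ ⟩
      D * (B (suc R) n + α (suc R) * e n (dbl (suc R))) + H n (suc R) ∎
      where
      D : Carrier
      D = 1# + Q (suc (n ℕ.+ n))

    odd : ℕ → Carrier
    odd n = ∏< n (λ k → 1# + Q (suc (k ℕ.+ k)))

    -- The bound n ≤ 2R kills the boundary term `H n R`, which carries 1/(q)_{n-2R-1}. What remains
    -- of `B-rec` is the recurrence of (-q;q²)_n/(q)_{2n}, whose consecutive quotient is (1 +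
    -- q^{2n+1}) divided by `step₂ n`.
    bailey-pair : ∀ R n → n < suc (dbl R) → B (suc R) n ≈ odd n * ip (n ℕ.+ n)
    bailey-pair R zero _ = begin
      B (suc R) 0                                            ≈⟨ Σ-head R _ ⟩
      1# * (1# * 1#) + Σ< R (λ r → α (suc r) * e 0 (dbl (suc r)))  ≈⟨ +-cong (*-identityˡ _) (Σ-0 R (λ r → trans (*-congˡ (zeroˡ _)) (zeroʳ _))) ⟩
      1# * 1# + 0#                                           ≈⟨ +-identityʳ _ ⟩
      1# * 1#                                                ∎
    bailey-pair R (suc n) n+1< = begin
      B (suc R) (suc n)
        ≈⟨ cancel (inv-spec (n ℕ.+ n)) (inv-spec (suc (n ℕ.+ n))) ⟩
      i * j * (step₂ n * B (suc R) (suc n))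
        ≈⟨ *-congˡ (B-rec R n) ⟩
      i * j * (D * B (suc R) n + H n R)
        ≈⟨ *-congˡ (trans (+-congˡ H≈0) (+-identityʳ _)) ⟩
      i * j * (D * B (suc R) n)
        ≈⟨ *-congˡ (*-congˡ (bailey-pair R n n<)) ⟩
      i * j * (D * (odd n * ip (n ℕ.+ n)))
        ≈⟨ solve 5 (λ i j d o p → i :* j :* (d :* (o :* p)) := o :* d :* (p :* i :* j)) refl _ _ _ _ _ ⟩
      odd (suc n) * ip (suc (suc (n ℕ.+ n)))
        ≈⟨ *-congˡ (reflexive (≡.cong (λ m → ip (suc m)) (ℕₚ.+-suc n n))) ⟨
      odd (suc n) * ip (suc n ℕ.+ suc n) ∎
      where
      i j D : Carrier
      i = inv (suc (n ℕ.+ n))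
      j = inv (suc (suc (n ℕ.+ n)))
      D = 1# + Q (suc (n ℕ.+ n))
      n< : n < suc (dbl R)
      n< = ℕₚ.<-trans (ℕₚ.n<1+n n) n+1<
      H≈0 : H n R ≈ 0#
      H≈0 = begin
        ι (+ 2) * (ι (sgn R) * (w * (J * u)))  ≈⟨ solve 5 (λ a s w J u → a :* (s :* (w :* (J :* u))) := J :* (a :* s :* w :* u)) refl _ _ w J u ⟩
        J * (ι (+ 2) * ι (sgn R) * w * u)      ≈⟨ *-congʳ (ipd-vanish n _ n<) ⟩
        0# * (ι (+ 2) * ι (sgn R) * w * u)     ≈⟨ zeroˡ _ ⟩
        0#                                     ∎
        where
        w J u : Carrier
        w = q * (W R * Q n)
        J = ipd n (suc (dbl R))
        u = ip (suc (dbl R) ℕ.+ n)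
      cancel : ∀ {a b x i j} → a * i ≈ 1# → b * j ≈ 1# → x ≈ i * j * (a * b * x)
      cancel {a} {b} {x} {i} {j} ai≈1 bj≈1 = sym (begin
        i * j * (a * b * x)    ≈⟨ solve 5 (λ a b x i j → i :* j :* (a :* b :* x) := (a :* i) :* (b :* j) :* x) refl _ _ _ _ _ ⟩
        a * i * (b * j) * x    ≈⟨ *-congʳ (*-cong ai≈1 bj≈1) ⟩
        1# * 1# * x            ≈⟨ trans (*-congʳ (*-identityˡ 1#)) (*-identityˡ x) ⟩
        x                      ∎)

    -- Creative telescoping for X_r when q^K = 0.

    module Truncated (K : ℕ) (Q-K : Q K ≈ 0#) where

      Q-≥K : ∀ m → Q (m ℕ.+ K) ≈ 0#
      Q-≥K m = trans (Q-+ m K) (trans (*-congˡ Q-K) (zeroʳ _))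

      inv-1 : ∀ k → Q (suc k) ≈ 0# → inv (suc k) ≈ 1#
      inv-1 k Q≈0 = begin
        inv (suc k)                     ≈⟨ solve 2 (λ x i → i := (:1 :- x) :* i :+ x :* i) refl _ _ ⟩
        (1# - Q (suc k)) * inv (suc k) + Q (suc k) * inv (suc k)
                                        ≈⟨ +-cong (inv-spec k) (trans (*-congʳ Q≈0) (zeroˡ _)) ⟩
        1# + 0#                         ≈⟨ +-identityʳ _ ⟩
        1#                              ∎

      -- G is the WZ mate of the summand E of X.
      E G : ℕ → ℕ → Carrier
      E r m = Q (suc m) * (poch m * poch m) * e (suc m) r
      G r m = Q (suc m) * (poch m * poch m) * (ipd m r * ip (r ℕ.+ suc m))

      sq : Carrier → Carrier
      sq x = x * x

      -- By `ipd-step`, `G r m` is (1 - q^{m+1-r}) times `E r m`. All terms are therefore polynomial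
      -- multiples of one product of reciprocals, and the claim is a polynomial identity modulo
      -- q^{m+1} = q^r q^{m+1-r}.
      wz-pair : ∀ r m → sq (1# - Q (suc r)) * E (suc r) m
        ≈ q * sq (1# - Q r) * E r m + (1# - Q (suc (r ℕ.+ r))) * (G r m - G r (suc m))
      wz-pair r m = begin
        sq (1# - Q (suc r)) * (N * (P * P) * (ipd m r * u))
          ≈⟨ *-cong (*-cong (minusʳ (Q-+ 1 r)) (minusʳ (Q-+ 1 r))) (*-congˡ (*-congʳ (ipd-step (suc m) r))) ⟩
        sq (1# - q * Y) * (N * (P * P) * ((1# - x) * J * u))
          -- As in `e-rec`, the last summand is a cofactor times `N * J - Y * x * J`, which `ipd-Q`
          -- makes vanish.
          ≈⟨ solve 7 (λ q N Y x J P u →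
               (:1 :- q :* Y) :* (:1 :- q :* Y) :* (N :* (P :* P) :* ((:1 :- x) :* J :* u))
               := q :* ((:1 :- Y) :* (:1 :- Y)) :* (N :* (P :* P) :* (J :* ((:1 :- q :* (Y :* N)) :* u)))
                  :+ (:1 :- q :* (Y :* Y)) :* (N :* (P :* P) :* ((:1 :- x) :* J :* ((:1 :- q :* (Y :* N)) :* u))
                       :- q :* N :* (P :* (:1 :- N) :* (P :* (:1 :- N))) :* (J :* u))
                  :+ (q :* N :+ q :* Y :- q :* q :* Y :* Y :* N :- con (+ 2) :* q :+ q :* q :* Y) :* (u :* N :* (P :* P)) :* (N :* J :- Y :* x :* J))
               refl q N Y x J P u ⟩
        _ ≈⟨ +-cong (+-cong (*-congˡ (*-congˡ (*-congˡ (sym ip-n))))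
               (*-cong (minusʳ (sym (Q-suc-+ r r)))
                 (+-cong (*-congˡ (*-cong (sym (ipd-step (suc m) r)) (sym ip-n)))
                   (-‿cong (*-cong (*-congʳ (sym (Q-+ 1 (suc m)))) (*-congˡ (reflexive (≡.cong ip (≡.sym (ℕₚ.+-suc r (suc m)))))))))))
               (trans (*-congˡ (trans (+-congʳ (ipd-Q (suc m) r)) (-‿inverseʳ _))) (zeroʳ _)) ⟩
        q * sq (1# - Y) * E r m + (1# - Q (suc (r ℕ.+ r))) * (G r m - G r (suc m)) + 0#
          ≈⟨ +-identityʳ _ ⟩
        q * sq (1# - Y) * E r m + (1# - Q (suc (r ℕ.+ r))) * (G r m - G r (suc m)) ∎
        where
        N Y x J P u : Carrier
        N = Q (suc m)
        Y = Q r
        x = Q (suc m ∸ r)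
        J = ipd (suc m) r
        P = poch m
        u = ip (suc (r ℕ.+ suc m))
        ip-n : ip (r ℕ.+ suc m) ≈ (1# - q * (Y * N)) * u
        ip-n = trans (ip-step (r ℕ.+ suc m)) (*-congʳ (minusʳ (Q-suc-+ r (suc m))))

      X : ℕ → Carrier
      X r = Σ< K (E r)

      X-rec : ∀ r → sq (1# - Q (suc r)) * X (suc r) ≈ q * sq (1# - Q r) * X r + (1# - Q (suc (r ℕ.+ r))) * G r 0
      X-rec r = begin
        sq (1# - Q (suc r)) * X (suc r)
          ≈⟨ *-Σ K _ _ ⟩
        Σ< K (λ m → sq (1# - Q (suc r)) * E (suc r) m)
          ≈⟨ Σ-cong K (wz-pair r) ⟩
        Σ< K (λ m → a * E r m + b * (G r m - G r (suc m)))
          ≈⟨ Σ-+ K _ _ ⟩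
        Σ< K (λ m → a * E r m) + Σ< K (λ m → b * (G r m - G r (suc m)))
          ≈⟨ +-cong (*-Σ K a (E r)) (*-Σ K b _) ⟨
        a * X r + b * Σ< K (λ m → G r m - G r (suc m))
          ≈⟨ +-congˡ (*-congˡ (Σ-telescope K (G r))) ⟩
        a * X r + b * (G r 0 - G r K)
          ≈⟨ +-congˡ (*-congˡ (minus-0 G-K)) ⟩
        a * X r + b * G r 0 ∎
        where
        a b : Carrier
        a = q * sq (1# - Q r)
        b = 1# - Q (suc (r ℕ.+ r))
        G-K : G r K ≈ 0#
        G-K = begin
          Q (suc K) * (poch K * poch K) * (ipd K r * ip (r ℕ.+ suc K))
            ≈⟨ *-congʳ (*-congʳ (Q-≥K 1)) ⟩
          0# * (poch K * poch K) * (ipd K r * ip (r ℕ.+ suc K))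
            ≈⟨ trans (*-congʳ (zeroˡ _)) (zeroˡ _) ⟩
          0# ∎

      -- At r = 0 the coefficient (1 - q^0)² removes X_0 from `X-rec`, so X_1 comes from the
      -- boundary term `G 0 0` alone. For r ≥ 1 that boundary term is 0, because it contains
      -- `ipd 0 r`, and each further step only multiplies (1 - q^r)² X_r by q.
      X-cleared : ∀ r → sq (1# - Q (suc r)) * X (suc r) ≈ Q (suc r)
      X-cleared zero = begin
        sq (1# - q) * X 1
          ≈⟨ X-rec 0 ⟩
        q * sq (1# - Q 0) * X 0 + (1# - q) * (q * (1# * 1#) * (1# * (1# * inv 1)))
          ≈⟨ +-cong (*-congʳ (*-congˡ (*-cong (minusʳ Q-0) (minusʳ Q-0)))) refl ⟩
        q * sq (1# - 1#) * X 0 + (1# - q) * (q * (1# * 1#) * (1# * (1# * inv 1)))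
          ≈⟨ solve 3 (λ q x i → q :* ((:1 :- :1) :* (:1 :- :1)) :* x :+ (:1 :- q) :* (q :* (:1 :* :1) :* (:1 :* (:1 :* i))) := q :* ((:1 :- q) :* i)) refl _ _ _ ⟩
        q * ((1# - q) * inv 1)
          ≈⟨ trans (*-congˡ (inv-spec 0)) (*-identityʳ _) ⟩
        q ∎
      X-cleared (suc r) = begin
        sq (1# - Q (suc (suc r))) * X (suc (suc r))
          ≈⟨ X-rec (suc r) ⟩
        q * sq (1# - Q (suc r)) * X (suc r) + (1# - Q (suc (suc r ℕ.+ suc r))) * G (suc r) 0
          ≈⟨ +-cong (trans (*-assoc _ _ _) (*-congˡ (X-cleared r))) (trans (*-congˡ (trans (*-congˡ (zeroˡ _)) (zeroʳ _))) (zeroʳ _)) ⟩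
        q * Q (suc r) + 0#
          ≈⟨ trans (+-identityʳ _) (sym (Q-+ 1 (suc r))) ⟩
        Q (suc (suc r)) ∎

      divide : ∀ k {x y} → (1# - Q (suc k)) * x ≈ y → x ≈ y * inv (suc k)
      divide k {x} {y} ax≈y = begin
        x                                   ≈⟨ *-identityʳ x ⟨
        x * 1#                              ≈⟨ *-congˡ (inv-spec k) ⟨
        x * ((1# - Q (suc k)) * inv (suc k))  ≈⟨ solve 3 (λ x a i → x :* (a :* i) := a :* x :* i) refl _ _ _ ⟩
        (1# - Q (suc k)) * x * inv (suc k)  ≈⟨ *-congʳ ax≈y ⟩
        y * inv (suc k)                     ∎

      X-suc : ∀ r → X (suc r) ≈ Q (suc r) * inv (suc r) * inv (suc r)
      X-suc r = divide r (divide r (trans (sym (*-assoc _ _ _)) (X-cleared r)))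

      poch-ip : ∀ n → poch n * ip n ≈ 1#
      poch-ip n = trans (sym (∏-* n _ _)) (∏-1 n inv-spec)

      -- Lambert series as finite double sums.

      lambert-vanish : ∀ n → Q (suc K ℕ.* suc n) ≈ 0#
      lambert-vanish n = trans (Q-cong (≡.trans (≡.cong (suc n ℕ.+_) (≡.trans (ℕₚ.*-suc K n) (ℕₚ.+-comm K _))) (≡.sym (ℕₚ.+-assoc (suc n) (K ℕ.* n) K)))) (Q-≥K (suc n ℕ.+ K ℕ.* n))

      -- Multiplication by 1 - q^{n+1} telescopes the sum, and the remainder q^{(K+1)(n+1)} is 0.
      geometric : ∀ n → Q (suc n) * inv (suc n) ≈ Σ< K (λ m → Q (suc m ℕ.* suc n))
      geometric n = sym (divide n (begin
        (1# - Q (suc n)) * Σ< K t         ≈⟨ *-Σ K _ t ⟩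
        Σ< K (λ m → (1# - Q (suc n)) * t m)  ≈⟨ Σ-cong K (λ m → trans (solve 2 (λ a b → (:1 :- a) :* b := b :- a :* b) refl _ _) (minusʳ (sym (Q-+ (suc n) _)))) ⟩
        Σ< K (λ m → t m - t (suc m))      ≈⟨ Σ-telescope K t ⟩
        t 0 - t K                         ≈⟨ minus-0 (lambert-vanish n) ⟩
        t 0                               ≈⟨ Q-cong (ℕₚ.*-identityˡ (suc n)) ⟩
        Q (suc n)                         ∎))
        where
        t : ℕ → Carrier
        t m = Q (suc m ℕ.* suc n)

      -- Summation by parts: multiplication by 1 - q^{n+1} replaces each weight m+1 by 1, up to a
      -- telescoping difference, and so reduces to `geometric`.
      geometric-weighted : ∀ n → Q (suc n) * inv (suc n) * inv (suc n) ≈ Σ< K (λ m → ι (+ suc m) * Q (suc m ℕ.* suc n))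
      geometric-weighted n = sym (divide n (begin
        (1# - Q (suc n)) * Σ< K (λ m → ι (+ suc m) * t m)
          ≈⟨ *-Σ K _ _ ⟩
        Σ< K (λ m → (1# - Q (suc n)) * (ι (+ suc m) * t m))
          ≈⟨ Σ-cong K term ⟩
        Σ< K (λ m → t m + (f m - f (suc m)))
          ≈⟨ Σ-+ K t _ ⟩
        Σ< K t + Σ< K (λ m → f m - f (suc m))
          ≈⟨ +-cong (sym (geometric n)) (Σ-telescope K f) ⟩
        Q (suc n) * inv (suc n) + (f 0 - f K)
          ≈⟨ +-congˡ (trans (minus-0 (trans (*-congˡ (lambert-vanish n)) (zeroʳ _))) (trans (*-congʳ ι-0) (zeroˡ _))) ⟩
        Q (suc n) * inv (suc n) + 0#
          ≈⟨ +-identityʳ _ ⟩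
        Q (suc n) * inv (suc n) ∎))
        where
        t f : ℕ → Carrier
        t m = Q (suc m ℕ.* suc n)
        f m = ι (+ m) * t m
        ι-suc : ∀ m → ι (+ suc m) ≈ 1# + ι (+ m)
        ι-suc m = trans (ι-+ (+ 1) (+ m)) (+-congʳ ι-1)
        term : ∀ m → (1# - Q (suc n)) * (ι (+ suc m) * t m) ≈ t m + (f m - f (suc m))
        term m = begin
          (1# - Q (suc n)) * (ι (+ suc m) * t m)
            ≈⟨ solve 3 (λ a i t → (:1 :- a) :* (i :* t) := i :* t :- i :* (a :* t)) refl _ _ _ ⟩
          ι (+ suc m) * t m - ι (+ suc m) * (Q (suc n) * t m)
            ≈⟨ +-cong (*-congʳ (ι-suc m)) (-‿cong (*-congˡ (sym (Q-+ (suc n) _)))) ⟩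
          (1# + ι (+ m)) * t m - f (suc m)
            ≈⟨ solve 3 (λ i t f → (:1 :+ i) :* t :- f := t :+ (i :* t :- f)) refl _ _ _ ⟩
          t m + (f m - f (suc m)) ∎

      S₁ S₂ : Carrier
      S₁ = Σ< K (λ n → ι (+ suc n) * (Q (suc n) * inv (suc n)))
      S₂ = Σ< K (λ n → ι (sgn (suc n)) * (Q (2 ℕ.* suc n ℕ.* suc (suc n)) * inv (2 ℕ.* suc n) * inv (2 ℕ.* suc n)))

      -- Both sides expand to the double sum of m q^{mn}; one sums over m first, the other over n.
      lambert : Σ< K (λ n → Q (suc n) * inv (suc n) * inv (suc n)) ≈ S₁
      lambert = begin
        Σ< K (λ n → Q (suc n) * inv (suc n) * inv (suc n))
          ≈⟨ Σ-cong K geometric-weighted ⟩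
        Σ< K (λ n → Σ< K (λ m → ι (+ suc m) * Q (suc m ℕ.* suc n)))
          ≈⟨ Σ-swap K K _ ⟩
        Σ< K (λ m → Σ< K (λ n → ι (+ suc m) * Q (suc m ℕ.* suc n)))
          ≈⟨ Σ-cong K (λ m → sym (*-Σ K _ _)) ⟩
        Σ< K (λ m → ι (+ suc m) * Σ< K (λ n → Q (suc m ℕ.* suc n)))
          ≈⟨ Σ-cong K (λ m → *-congˡ (trans (Σ-cong K (λ n → Q-cong (ℕₚ.*-comm (suc m) (suc n)))) (sym (geometric m)))) ⟩
        S₁ ∎

      X-zero : X 0 ≈ S₁
      X-zero = trans (Σ-cong K term) lambert
        where
        term : ∀ m → E 0 m ≈ Q (suc m) * inv (suc m) * inv (suc m)
        term m = begin
          Q (suc m) * (poch m * poch m) * (ip m * inv (suc m) * (ip m * inv (suc m)))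
            ≈⟨ solve 4 (λ a p i j → a :* (p :* p) :* (i :* j :* (i :* j)) := p :* i :* (p :* i) :* (a :* j :* j)) refl _ _ _ _ ⟩
          poch m * ip m * (poch m * ip m) * (Q (suc m) * inv (suc m) * inv (suc m))
            ≈⟨ *-congʳ (*-cong (poch-ip m) (poch-ip m)) ⟩
          1# * 1# * (Q (suc m) * inv (suc m) * inv (suc m))
            ≈⟨ trans (*-congʳ (*-identityˡ 1#)) (*-identityˡ _) ⟩
          Q (suc m) * inv (suc m) * inv (suc m) ∎

      bailey-sum : Σ< K (λ m → Q (suc m) * (poch m * poch m) * (odd (suc m) * ip (suc m ℕ.+ suc m))) ≈ S₁ + ι (+ 2) * S₂
      bailey-sum = begin
        Σ< K (λ m → w m * (odd (suc m) * ip (suc m ℕ.+ suc m)))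
          -- The choice R = K meets the bound of `bailey-pair` for every m < K at once, so the range
          -- of r does not depend on m and the sums can be interchanged.
          ≈⟨ Σ-cong< K (λ m m<K → *-congˡ (bailey-pair K (suc m) (s≤s (ℕₚ.≤-trans m<K (n≤dbl K))))) ⟨
        Σ< K (λ m → w m * Σ< (suc K) (λ r → α r * e (suc m) (dbl r)))
          ≈⟨ Σ-cong K (λ m → *-Σ (suc K) _ _) ⟩
        Σ< K (λ m → Σ< (suc K) (λ r → w m * (α r * e (suc m) (dbl r))))
          ≈⟨ Σ-swap K (suc K) _ ⟩
        Σ< (suc K) (λ r → Σ< K (λ m → w m * (α r * e (suc m) (dbl r))))
          ≈⟨ Σ-cong (suc K) (λ r → trans (Σ-cong K (λ m → solve 3 (λ w a e → w :* (a :* e) := a :* (w :* e)) refl _ _ _)) (sym (*-Σ K (α r) _))) ⟩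
        Σ< (suc K) (λ r → α r * X (dbl r))
          ≈⟨ Σ-head K _ ⟩
        1# * X 0 + Σ< K (λ r → α (suc r) * X (dbl (suc r)))
          ≈⟨ +-cong (trans (*-identityˡ _) X-zero) (trans (Σ-cong K term) (sym (*-Σ K _ _))) ⟩
        S₁ + ι (+ 2) * S₂ ∎
        where
        w : ℕ → Carrier
        w m = Q (suc m) * (poch m * poch m)
        exponent : ∀ r → 2 ℕ.* (suc r ℕ.* suc r) ℕ.+ 2 ℕ.* suc r ≡ 2 ℕ.* suc r ℕ.* suc (suc r)
        exponent = ℕ-solve 1 (λ r → ncon 2 :×: ((ncon 1 :⊹: r) :×: (ncon 1 :⊹: r)) :⊹: ncon 2 :×: (ncon 1 :⊹: r)
          :≡: ncon 2 :×: (ncon 1 :⊹: r) :×: (ncon 2 :⊹: r)) ≡.refl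
        X-even : ∀ r → X (dbl (suc r)) ≈ Q (2 ℕ.* suc r) * inv (2 ℕ.* suc r) * inv (2 ℕ.* suc r)
        X-even r = trans (X-suc (suc (dbl r))) (reflexive (≡.cong (λ k → Q k * inv k * inv k) (dbl≡ (suc r))))
        term : ∀ r → α (suc r) * X (dbl (suc r))
          ≈ ι (+ 2) * (ι (sgn (suc r)) * (Q (2 ℕ.* suc r ℕ.* suc (suc r)) * inv (2 ℕ.* suc r) * inv (2 ℕ.* suc r)))
        term r = begin
          α (suc r) * X (dbl (suc r))
            ≈⟨ *-congˡ (X-even r) ⟩
          ι (+ 2) * (ι (sgn (suc r)) * Q (2 ℕ.* (suc r ℕ.* suc r))) * (Q (2 ℕ.* suc r) * inv (2 ℕ.* suc r) * inv (2 ℕ.* suc r))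
            ≈⟨ solve 5 (λ c s a b i → c :* (s :* a) :* (b :* i :* i) := c :* (s :* (a :* b :* i :* i))) refl _ _ _ _ _ ⟩
          ι (+ 2) * (ι (sgn (suc r)) * (Q (2 ℕ.* (suc r ℕ.* suc r)) * Q (2 ℕ.* suc r) * inv (2 ℕ.* suc r) * inv (2 ℕ.* suc r)))
            ≈⟨ *-congˡ (*-congˡ (*-congʳ (*-congʳ (trans (sym (Q-+ _ _)) (Q-cong (exponent r)))))) ⟩
          ι (+ 2) * (ι (sgn (suc r)) * (Q (2 ℕ.* suc r ℕ.* suc (suc r)) * inv (2 ℕ.* suc r) * inv (2 ℕ.* suc r))) ∎

      -- Extracting the infinite products from the summands.

      A⁺ A⁻ : Carrier
      A⁺ = ∏< K (λ k → 1# + Q (2 ℕ.+ 2 ℕ.* k))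
      A⁻ = ∏< K (λ k → inv (2 ℕ.+ 2 ℕ.* k))

      negpoch even : ℕ → Carrier
      negpoch n = ∏< n (λ k → 1# + Q (suc k))
      even    n = ∏< n (λ k → 1# + Q (2 ℕ.+ 2 ℕ.* k))

      negpoch-odd-even : ∀ n → negpoch (n ℕ.+ n) ≈ odd n * even n
      negpoch-odd-even zero    = sym (*-identityˡ 1#)
      negpoch-odd-even (suc n) = begin
        negpoch (suc n ℕ.+ suc n)
          ≡⟨ ≡.cong (λ m → negpoch (suc m)) (ℕₚ.+-suc n n) ⟩
        negpoch (n ℕ.+ n) * (1# + Q (suc (n ℕ.+ n))) * (1# + Q (suc (suc (n ℕ.+ n))))
          ≈⟨ *-cong (*-congʳ (negpoch-odd-even n)) (+-congˡ (Q-cong (≡.cong (λ m → suc (suc (n ℕ.+ m))) (≡.sym (ℕₚ.+-identityʳ n))))) ⟩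
        odd n * even n * (1# + Q (suc (n ℕ.+ n))) * (1# + Q (2 ℕ.+ 2 ℕ.* n))
          ≈⟨ solve 4 (λ o e a b → o :* e :* a :* b := o :* a :* (e :* b)) refl _ _ _ _ ⟩
        odd (suc n) * even (suc n) ∎

      negpoch-tail : ∀ n → negpoch n * ∏< n (λ k → 1# + Q (suc n ℕ.+ k)) ≈ odd n * even n
      negpoch-tail n = begin
        negpoch n * ∏< n (λ k → 1# + Q (suc n ℕ.+ k))   ≈⟨ *-congˡ (∏-cong n (λ k → +-congˡ (Q-cong (≡.cong suc (ℕₚ.+-comm n k))))) ⟩
        negpoch n * ∏< n (λ k → 1# + Q (suc (k ℕ.+ n))) ≈⟨ ∏-split n n _ ⟨
        negpoch (n ℕ.+ n)                               ≈⟨ negpoch-odd-even n ⟩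
        odd n * even n                                  ∎

      inv-tail : ∀ n → ∏< n (λ k → inv (suc n ℕ.+ k)) ≈ poch n * ip (n ℕ.+ n)
      inv-tail n = begin
        p                              ≈⟨ *-identityˡ p ⟨
        1# * p                         ≈⟨ *-congʳ (poch-ip n) ⟨
        poch n * ip n * p              ≈⟨ *-assoc _ _ _ ⟩
        poch n * (ip n * p)            ≈⟨ *-congˡ (*-congˡ (∏-cong n (λ k → reflexive (≡.cong (λ m → inv (suc m)) (ℕₚ.+-comm n k))))) ⟩
        poch n * (ip n * ∏< n (λ k → inv (suc (k ℕ.+ n))))  ≈⟨ *-congˡ (∏-split n n _) ⟨
        poch n * ip (n ℕ.+ n)          ∎
        where
        p : Carrier
        p = ∏< n (λ k → inv (suc n ℕ.+ k))

      shift-index : ∀ n k → 2 ℕ.* n ℕ.+ 2 ℕ.+ 2 ℕ.* k ≡ 2 ℕ.+ 2 ℕ.* (k ℕ.+ n)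
      shift-index = ℕ-solve 2 (λ n k → ncon 2 :×: n :⊹: ncon 2 :⊹: ncon 2 :×: k :≡: ncon 2 :⊹: ncon 2 :×: (k :⊹: n)) ≡.refl

      Q-even≈0 : ∀ k → Q (2 ℕ.+ 2 ℕ.* (k ℕ.+ K)) ≈ 0#
      Q-even≈0 k = trans (Q-cong (exponent k K)) (Q-≥K (2 ℕ.+ 2 ℕ.* k ℕ.+ K))
        where
        exponent : ∀ k K → 2 ℕ.+ 2 ℕ.* (k ℕ.+ K) ≡ 2 ℕ.+ 2 ℕ.* k ℕ.+ K ℕ.+ K
        exponent = ℕ-solve 2 (λ k K → ncon 2 :⊹: ncon 2 :×: (k :⊹: K) :≡: ncon 2 :⊹: ncon 2 :×: k :⊹: K :⊹: K) ≡.refl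

      A⁺-tail : ∀ n → even n * ∏< K (λ k → 1# + Q (2 ℕ.* n ℕ.+ 2 ℕ.+ 2 ℕ.* k)) ≈ A⁺
      A⁺-tail n = trans (*-congˡ (∏-cong K (λ k → +-congˡ (Q-cong (shift-index n k)))))
        (∏-shift K n (λ k → trans (+-congˡ (Q-even≈0 k)) (+-identityʳ 1#)))

      poch-negpoch : ∀ n → poch n * negpoch n * ∏< n (λ k → inv (2 ℕ.+ 2 ℕ.* k)) ≈ 1#
      poch-negpoch n = trans (*-congʳ (sym (∏-* n _ _))) (trans (sym (∏-* n _ _)) (∏-1 n factor))
        where
        factor : ∀ k → (1# - Q (suc k)) * (1# + Q (suc k)) * inv (2 ℕ.+ 2 ℕ.* k) ≈ 1#
        factor k = begin
          (1# - Q (suc k)) * (1# + Q (suc k)) * inv (2 ℕ.+ 2 ℕ.* k)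
            ≈⟨ *-congʳ (solve 1 (λ a → (:1 :- a) :* (:1 :+ a) := :1 :- a :* a) refl _) ⟩
          (1# - Q (suc k) * Q (suc k)) * inv (2 ℕ.+ 2 ℕ.* k)
            ≈⟨ *-congʳ (minusʳ (trans (sym (Q-+ (suc k) (suc k))) (Q-cong (≡.trans (≡.cong suc (ℕₚ.+-suc k k)) (≡.cong (λ m → suc (suc (k ℕ.+ m))) (≡.sym (ℕₚ.+-identityʳ k))))))) ⟩
          (1# - Q (2 ℕ.+ 2 ℕ.* k)) * inv (2 ℕ.+ 2 ℕ.* k)
            ≈⟨ inv-spec (suc (2 ℕ.* k)) ⟩
          1# ∎

      -- The missing factors form (q²;q²)_n, written as (q)_n (-q)_n because the two parts go
      -- different ways: (-q)_n completes (-q^{n+1})_n to (-q)_{2n}, and (q)_n joins the numerator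
      -- left by `inv-tail`.
      A⁻-tail : ∀ n → ∏< K (λ k → inv (2 ℕ.* n ℕ.+ 2 ℕ.+ 2 ℕ.* k)) ≈ poch n * negpoch n * A⁻
      A⁻-tail n = begin
        t                              ≈⟨ *-identityˡ t ⟨
        1# * t                         ≈⟨ *-congʳ (poch-negpoch n) ⟨
        poch n * negpoch n * p * t     ≈⟨ *-assoc _ _ _ ⟩
        poch n * negpoch n * (p * t)   ≈⟨ *-congˡ (trans (*-congˡ (∏-cong K (λ k → reflexive (≡.cong inv (shift-index n k))))) (∏-shift K n (λ k → inv-1 _ (Q-even≈0 k)))) ⟩
        poch n * negpoch n * A⁻        ∎
        where
        p t : Carrier
        p = ∏< n (λ k → inv (2 ℕ.+ 2 ℕ.* k))
        t = ∏< K (λ k → inv (2 ℕ.* n ℕ.+ 2 ℕ.+ 2 ℕ.* k))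

      -- The factors stand in the order of `sptTerm`, so that the two can be compared factor by
      -- factor.
      summand : ℕ → Carrier
      summand n = Q n * ∏< n (λ k → 1# + Q (suc n ℕ.+ k)) * ∏< K (λ k → 1# + Q (2 ℕ.* n ℕ.+ 2 ℕ.+ 2 ℕ.* k))
        * inv n * inv n * ∏< n (λ k → inv (suc n ℕ.+ k)) * ∏< K (λ k → inv (2 ℕ.* n ℕ.+ 2 ℕ.+ 2 ℕ.* k))

      -- Both `inv-tail` and `A⁻-tail` supply a factor (q)_n; against 1/(1 - q^n)² they leave
      -- (q)_{n-1}². The factor (-q²;q²)_n contained in (-q)_{2n} completes the remaining even
      -- product to `A⁺`.
      summand-reduce : ∀ m → summand (suc m) ≈ A⁺ * A⁻ * (Q (suc m) * (poch m * poch m) * (odd (suc m) * ip (suc m ℕ.+ suc m)))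
      summand-reduce m = begin
        x * P₁ * P₂ * i * i * ∏< n (λ k → inv (suc n ℕ.+ k)) * ∏< K (λ k → inv (2 ℕ.* n ℕ.+ 2 ℕ.+ 2 ℕ.* k))
          ≈⟨ *-cong (*-congˡ (inv-tail n)) (A⁻-tail n) ⟩
        x * P₁ * P₂ * i * i * (p * a * u) * (p * a * negpoch n * A⁻)
          ≈⟨ solve 9 (λ x P₁ P₂ i p a u n A →
               x :* P₁ :* P₂ :* i :* i :* (p :* a :* u) :* (p :* a :* n :* A)
               := A :* (x :* (p :* p) :* u) :* (a :* i) :* (a :* i) :* (n :* P₁ :* P₂)) refl x P₁ P₂ i p a u (negpoch n) A⁻ ⟩
        A⁻ * (x * (p * p) * u) * (a * i) * (a * i) * (negpoch n * P₁ * P₂)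
          ≈⟨ *-cong (trans (*-cong (trans (*-congˡ (inv-spec m)) (*-identityʳ _)) (inv-spec m)) (*-identityʳ _)) (trans (*-congʳ (negpoch-tail n)) (trans (*-assoc _ _ _) (*-congˡ (A⁺-tail n)))) ⟩
        A⁻ * (x * (p * p) * u) * (odd n * A⁺)
          ≈⟨ solve 6 (λ x p u A o B → A :* (x :* (p :* p) :* u) :* (o :* B) := B :* A :* (x :* (p :* p) :* (o :* u))) refl x p u A⁻ (odd n) A⁺ ⟩
        A⁺ * A⁻ * (x * (p * p) * (odd n * u)) ∎
        where
        n : ℕ
        n = suc m
        x P₁ P₂ i p a u : Carrier
        x = Q n
        P₁ = ∏< n (λ k → 1# + Q (suc n ℕ.+ k))
        P₂ = ∏< K (λ k → 1# + Q (2 ℕ.* n ℕ.+ 2 ℕ.+ 2 ℕ.* k))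
        i = inv n
        p = poch m
        a = 1# - Q n
        u = ip (n ℕ.+ n)

      truncated-identity : Σ< K (λ m → summand (suc m)) ≈ A⁺ * A⁻ * S₁ + ι (+ 2) * (A⁺ * A⁻ * S₂)
      truncated-identity = begin
        Σ< K (λ m → summand (suc m))
          ≈⟨ Σ-cong K summand-reduce ⟩
        Σ< K (λ m → A⁺ * A⁻ * (Q (suc m) * (poch m * poch m) * (odd (suc m) * ip (suc m ℕ.+ suc m))))
          ≈⟨ *-Σ K _ _ ⟨
        A⁺ * A⁻ * Σ< K (λ m → Q (suc m) * (poch m * poch m) * (odd (suc m) * ip (suc m ℕ.+ suc m)))
          ≈⟨ *-congˡ bailey-sum ⟩
        A⁺ * A⁻ * (S₁ + ι (+ 2) * S₂)
          ≈⟨ solve 4 (λ a s c t → a :* (s :+ c :* t) := a :* s :+ c :* (a :* t)) refl _ _ _ _ ⟩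
        A⁺ * A⁻ * S₁ + ι (+ 2) * (A⁺ * A⁻ * S₂) ∎

-- Power series modulo q^{N+1}

sumTo-cong : ∀ n {f g} → (∀ i → i ≤ n → f i ≡ g i) → sumTo n f ≡ sumTo n g
sumTo-cong zero    e = e 0 z≤n
sumTo-cong (suc n) e = ≡.cong₂ ℤ._+_ (sumTo-cong n (λ i i≤n → e i (ℕₚ.m≤n⇒m≤1+n i≤n))) (e (suc n) ℕₚ.≤-refl)

sumTo-0 : ∀ n {f} → (∀ i → i ≤ n → f i ≡ + 0) → sumTo n f ≡ + 0
sumTo-0 zero    e = e 0 z≤n
sumTo-0 (suc n) e = ≡.cong₂ ℤ._+_ (sumTo-0 n (λ i i≤n → e i (ℕₚ.m≤n⇒m≤1+n i≤n))) (e (suc n) ℕₚ.≤-refl)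

sumTo-head : ∀ n f → sumTo (suc n) f ≡ f 0 ℤ.+ sumTo n (λ i → f (suc i))
sumTo-head zero    f = ≡.refl
sumTo-head (suc n) f = ≡.trans (≡.cong (ℤ._+ f (suc (suc n))) (sumTo-head n f)) (ℤₚ.+-assoc (f 0) _ _)

sumTo-+ : ∀ n f g → sumTo n (λ i → f i ℤ.+ g i) ≡ sumTo n f ℤ.+ sumTo n g
sumTo-+ zero    f g = ≡.refl
sumTo-+ (suc n) f g = ≡.trans (≡.cong (ℤ._+ (f (suc n) ℤ.+ g (suc n))) (sumTo-+ n f g))
  (interchange (sumTo n f) (sumTo n g) (f (suc n)) (g (suc n)))
  where open import Algebra.Properties.CommutativeSemigroup ℤₚ.+-commutativeSemigroup using (interchange)

sumTo-* : ∀ n c f → sumTo n (λ i → c ℤ.* f i) ≡ c ℤ.* sumTo n f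
sumTo-* zero    c f = ≡.refl
sumTo-* (suc n) c f = ≡.trans (≡.cong (ℤ._+ c ℤ.* f (suc n)) (sumTo-* n c f)) (≡.sym (ℤₚ.*-distribˡ-+ c _ _))

tail : PS → PS
tail f n = f (suc n)

infix 4 _≐_

_≐_ : PS → PS → Set
f ≐ g = ∀ n → f n ≡ g n

⊛-cong≤ : ∀ n {f f′ g g′} → (∀ i → i ≤ n → f i ≡ f′ i) → (∀ i → i ≤ n → g i ≡ g′ i) → (f ⊛ g) n ≡ (f′ ⊛ g′) n
⊛-cong≤ n f≡ g≡ = sumTo-cong n (λ i i≤n → ≡.cong₂ ℤ._*_ (f≡ i i≤n) (g≡ (n ∸ i) (ℕₚ.m∸n≤m n i)))

-- Peeling off constant terms, here of the left factor and in `⊛-last` of the right one, lets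
-- commutativity and associativity go by induction on the coefficient, with no reindexing of double
-- sums.
⊛-head : ∀ f g n → (f ⊛ g) (suc n) ≡ f 0 ℤ.* g (suc n) ℤ.+ (tail f ⊛ g) n
⊛-head f g n = sumTo-head n _

⊛-last : ∀ f g n → (f ⊛ g) (suc n) ≡ (f ⊛ tail g) n ℤ.+ f (suc n) ℤ.* g 0
⊛-last f g n = ≡.cong₂ ℤ._+_
  (sumTo-cong n (λ i i≤n → ≡.cong (λ m → f i ℤ.* g m) (ℕₚ.+-∸-assoc 1 i≤n)))
  (≡.cong (λ m → f (suc n) ℤ.* g m) (ℕₚ.n∸n≡0 n))

⊛-order : ∀ k f g → (∀ i → i < k → f i ≡ + 0) → ∀ i → i < k → (f ⊛ g) i ≡ + 0
⊛-order k f g f≡0 i i<k = sumTo-0 i (λ j j≤i → ≡.cong (ℤ._* g (i ∸ j)) (f≡0 j (ℕₚ.≤-<-trans j≤i i<k)))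

⊛-comm : ∀ f g → f ⊛ g ≐ g ⊛ f
⊛-comm f g zero    = ℤₚ.*-comm (f 0) (g 0)
⊛-comm f g (suc n) = begin
  (f ⊛ g) (suc n)                              ≡⟨ ⊛-head f g n ⟩
  f 0 ℤ.* g (suc n) ℤ.+ (tail f ⊛ g) n         ≡⟨ ≡.cong₂ ℤ._+_ (ℤₚ.*-comm (f 0) _) (⊛-comm (tail f) g n) ⟩
  g (suc n) ℤ.* f 0 ℤ.+ (g ⊛ tail f) n         ≡⟨ ℤₚ.+-comm (g (suc n) ℤ.* f 0) _ ⟩
  (g ⊛ tail f) n ℤ.+ g (suc n) ℤ.* f 0         ≡⟨ ⊛-last g f n ⟨
  (g ⊛ f) (suc n)                              ∎
  where open ≡.≡-Reasoning

⊛-distribʳ : ∀ f g h → (g ⊕ h) ⊛ f ≐ g ⊛ f ⊕ h ⊛ f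
⊛-distribʳ f g h n = ≡.trans (sumTo-cong n (λ i _ → ℤₚ.*-distribʳ-+ (f (n ∸ i)) (g i) (h i))) (sumTo-+ n _ _)

scale-⊛ : ∀ c f g → scale c f ⊛ g ≐ scale c (f ⊛ g)
scale-⊛ c f g n = ≡.trans (sumTo-cong n (λ i _ → ℤₚ.*-assoc c (f i) _)) (sumTo-* n c _)

⊛-assoc : ∀ f g h → (f ⊛ g) ⊛ h ≐ f ⊛ (g ⊛ h)
⊛-assoc f g h zero    = ℤₚ.*-assoc (f 0) (g 0) (h 0)
⊛-assoc f g h (suc n) = begin
  ((f ⊛ g) ⊛ h) (suc n)
    ≡⟨ ⊛-head (f ⊛ g) h n ⟩
  f 0 ℤ.* g 0 ℤ.* h (suc n) ℤ.+ (tail (f ⊛ g) ⊛ h) n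
    ≡⟨ ≡.cong (λ a → f 0 ℤ.* g 0 ℤ.* h (suc n) ℤ.+ a) (⊛-cong≤ n {g = h} (λ i _ → ⊛-head f g i) (λ _ _ → ≡.refl)) ⟩
  f 0 ℤ.* g 0 ℤ.* h (suc n) ℤ.+ ((scale (f 0) (tail g) ⊕ tail f ⊛ g) ⊛ h) n
    ≡⟨ ≡.cong (λ a → f 0 ℤ.* g 0 ℤ.* h (suc n) ℤ.+ a) (⊛-distribʳ h (scale (f 0) (tail g)) (tail f ⊛ g) n) ⟩
  f 0 ℤ.* g 0 ℤ.* h (suc n) ℤ.+ ((scale (f 0) (tail g) ⊛ h) n ℤ.+ ((tail f ⊛ g) ⊛ h) n)
    ≡⟨ ≡.cong₂ (λ a b → f 0 ℤ.* g 0 ℤ.* h (suc n) ℤ.+ (a ℤ.+ b)) (scale-⊛ (f 0) (tail g) h n) (⊛-assoc (tail f) g h n) ⟩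
  f 0 ℤ.* g 0 ℤ.* h (suc n) ℤ.+ (f 0 ℤ.* (tail g ⊛ h) n ℤ.+ (tail f ⊛ (g ⊛ h)) n)
    ≡⟨ ℤₚ.+-assoc (f 0 ℤ.* g 0 ℤ.* h (suc n)) _ _ ⟨
  f 0 ℤ.* g 0 ℤ.* h (suc n) ℤ.+ f 0 ℤ.* (tail g ⊛ h) n ℤ.+ (tail f ⊛ (g ⊛ h)) n
    ≡⟨ ≡.cong (λ a → a ℤ.+ f 0 ℤ.* (tail g ⊛ h) n ℤ.+ (tail f ⊛ (g ⊛ h)) n) (ℤₚ.*-assoc (f 0) (g 0) (h (suc n))) ⟩
  f 0 ℤ.* (g 0 ℤ.* h (suc n)) ℤ.+ f 0 ℤ.* (tail g ⊛ h) n ℤ.+ (tail f ⊛ (g ⊛ h)) n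
    ≡⟨ ≡.cong (ℤ._+ (tail f ⊛ (g ⊛ h)) n) (ℤₚ.*-distribˡ-+ (f 0) _ _) ⟨
  f 0 ℤ.* (g 0 ℤ.* h (suc n) ℤ.+ (tail g ⊛ h) n) ℤ.+ (tail f ⊛ (g ⊛ h)) n
    ≡⟨ ≡.cong (λ a → f 0 ℤ.* a ℤ.+ (tail f ⊛ (g ⊛ h)) n) (⊛-head g h n) ⟨
  f 0 ℤ.* (g ⊛ h) (suc n) ℤ.+ (tail f ⊛ (g ⊛ h)) n
    ≡⟨ ⊛-head f (g ⊛ h) n ⟨
  (f ⊛ (g ⊛ h)) (suc n) ∎
  where open ≡.≡-Reasoning

-- Monomials and geometric series.

mono-⊛-suc : ∀ k f n → (mono (suc k) ⊛ f) (suc n) ≡ (mono k ⊛ f) n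
mono-⊛-suc k f n = ≡.trans (⊛-head (mono (suc k)) f n) (ℤₚ.+-identityˡ _)

mono-0-⊛ : ∀ f → mono 0 ⊛ f ≐ f
mono-0-⊛ f zero    = ℤₚ.*-identityˡ (f 0)
mono-0-⊛ f (suc n) = ≡.trans (⊛-head (mono 0) f n) (≡.trans
  (≡.cong₂ ℤ._+_ (ℤₚ.*-identityˡ (f (suc n))) (sumTo-0 n (λ _ _ → ≡.refl))) (ℤₚ.+-identityʳ _))

mono-0 : mono 0 ≐ one
mono-0 zero    = ≡.refl
mono-0 (suc n) = ≡.refl

⊛-identityˡ : ∀ f → one ⊛ f ≐ f
⊛-identityˡ f n = ≡.trans (⊛-cong≤ n {g = f} (λ i _ → ≡.sym (mono-0 i)) (λ _ _ → ≡.refl)) (mono-0-⊛ f n)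

mono-⊛-shift : ∀ k f n → (mono k ⊛ f) (k ℕ.+ n) ≡ f n
mono-⊛-shift zero    f n = mono-0-⊛ f n
mono-⊛-shift (suc k) f n = ≡.trans (mono-⊛-suc k f (k ℕ.+ n)) (mono-⊛-shift k f n)

mono-order : ∀ k i → i < k → mono k i ≡ + 0
mono-order (suc k) zero    _         = ≡.refl
mono-order (suc k) (suc i) (s≤s i<k) = mono-order k i i<k

mono-+ : ∀ m n → mono (m ℕ.+ n) ≐ mono m ⊛ mono n
mono-+ zero    n i       = ≡.sym (mono-0-⊛ (mono n) i)
mono-+ (suc m) n zero    = ≡.refl
mono-+ (suc m) n (suc i) = ≡.trans (mono-+ m n i) (≡.sym (mono-⊛-suc m (mono n) i))

geom-shift : ∀ k n → geom k (k ℕ.+ n) ≡ geom k n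
geom-shift k n with k ∣? (k ℕ.+ n) | k ∣? n
... | yes _ | yes _ = ≡.refl
... | no  _ | no  _ = ≡.refl
... | yes p | no ¬q = contradiction (∣m+n∣m⇒∣n p ∣-refl) ¬q
... | no ¬p | yes q = contradiction (∣m∣n⇒∣m+n ∣-refl q) ¬p

geom-small : ∀ k n → n < k → geom k n ≡ one n
geom-small k zero    _ with k ∣? 0
... | yes _ = ≡.refl
... | no ¬p = contradiction (k ∣0) ¬p
geom-small k (suc n) n<k with k ∣? suc n
... | yes p = contradiction (∣⇒≤ p) (ℕₚ.<⇒≱ n<k)
... | no  _ = ≡.refl

-- Below exponent k+1 the product has no terms; from there on the claim is that divisibility by k+1
-- is unchanged when k+1 is added.
geom-unfold : ∀ k → geom (suc k) ≐ one ⊕ mono (suc k) ⊛ geom (suc k)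
geom-unfold k n with n ℕ.<? suc k
... | yes n<k = ≡.trans (geom-small (suc k) n n<k) (≡.sym (≡.trans
  (≡.cong (λ a → one n ℤ.+ a) (⊛-order (suc k) (mono (suc k)) (geom (suc k)) (mono-order (suc k)) n n<k)) (ℤₚ.+-identityʳ _)))
... | no  n≮k = ≡.subst (λ m → geom (suc k) m ≡ one m ℤ.+ (mono (suc k) ⊛ geom (suc k)) m)
  (ℕₚ.m+[n∸m]≡n (ℕₚ.≮⇒≥ n≮k))
  (≡.trans (geom-shift (suc k) d) (≡.sym (≡.trans (ℤₚ.+-identityˡ _) (mono-⊛-shift (suc k) (geom (suc k)) d))))
  where
  d : ℕ
  d = n ∸ suc k

module Modulo (N : ℕ) where

  infix 4 _≈_

  -- Congruence modulo q^{N+1}; a record so that f and g can be inferred from a proof.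
  record _≈_ (f g : PS) : Set where
    constructor mk
    field
      at : ∀ i → i ≤ N → f i ≡ g i
  open _≈_ public

  ≐⇒≈ : ∀ {f g} → f ≐ g → f ≈ g
  ≐⇒≈ e = mk (λ i _ → e i)

  ⊛-cong : ∀ {f f′ g g′} → f ≈ f′ → g ≈ g′ → f ⊛ g ≈ f′ ⊛ g′
  ⊛-cong f≈ g≈ = mk (λ i i≤N → ⊛-cong≤ i (λ j j≤i → at f≈ j (ℕₚ.≤-trans j≤i i≤N)) (λ j j≤i → at g≈ j (ℕₚ.≤-trans j≤i i≤N)))

  ring : CommutativeRing _ _
  ring = record
    { Carrier = PS ; _≈_ = _≈_ ; _+_ = _⊕_ ; _*_ = _⊛_ ; -_ = λ f n → ℤ.- f n ; 0# = λ _ → + 0 ; 1# = one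
    ; isCommutativeRing = record
      { isRing = record
        { +-isAbelianGroup = record
          { isGroup = record
            { isMonoid = record
              { isSemigroup = record
                { isMagma = record
                  { isEquivalence = record
                    { refl  = mk (λ _ _ → ≡.refl)
                    ; sym   = λ e → mk (λ i i≤N → ≡.sym (at e i i≤N))
                    ; trans = λ e e′ → mk (λ i i≤N → ≡.trans (at e i i≤N) (at e′ i i≤N))
                    }
                  ; ∙-cong = λ e e′ → mk (λ i i≤N → ≡.cong₂ ℤ._+_ (at e i i≤N) (at e′ i i≤N))
                  }
                ; assoc = λ f g h → ≐⇒≈ (λ i → ℤₚ.+-assoc (f i) (g i) (h i))
                }
              ; identity = (λ f → ≐⇒≈ (λ i → ℤₚ.+-identityˡ (f i))) , (λ f → ≐⇒≈ (λ i → ℤₚ.+-identityʳ (f i)))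
              }
            ; inverse = (λ f → ≐⇒≈ (λ i → ℤₚ.+-inverseˡ (f i))) , (λ f → ≐⇒≈ (λ i → ℤₚ.+-inverseʳ (f i)))
            ; ⁻¹-cong = λ e → mk (λ i i≤N → ≡.cong ℤ.-_ (at e i i≤N))
            }
          ; comm = λ f g → ≐⇒≈ (λ i → ℤₚ.+-comm (f i) (g i))
          }
        ; *-cong     = ⊛-cong
        ; *-assoc    = λ f g h → ≐⇒≈ (⊛-assoc f g h)
        ; *-identity = (λ f → ≐⇒≈ (⊛-identityˡ f)) , (λ f → ≐⇒≈ (λ i → ≡.trans (⊛-comm f one i) (⊛-identityˡ f i)))
        ; distrib    = (λ f g h → ≐⇒≈ (λ i → ≡.trans (⊛-comm f (g ⊕ h) i) (≡.trans (⊛-distribʳ f g h i)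
                         (≡.cong₂ ℤ._+_ (⊛-comm g f i) (⊛-comm h f i)))))
                     , (λ f g h → ≐⇒≈ (⊛-distribʳ f g h))
        }
      ; *-comm = λ f g → ≐⇒≈ (⊛-comm f g)
      }
    }

  open CommutativeRing ring using (setoid; refl; trans; *-cong; *-identityʳ)
  open import Relation.Binary.Reasoning.Setoid setoid

  scale≈ : ∀ c f → scale c f ≈ scale c one ⊛ f
  scale≈ c f = ≐⇒≈ (λ i → ≡.sym (≡.trans (scale-⊛ c one f i) (≡.cong (c ℤ.*_) (⊛-identityˡ f i))))

  constants : ℤ.+-*-rawRing -Raw-AlmostCommutative⟶ fromCommutativeRing ring
  constants = record
    { ⟦_⟧    = λ c → scale c one
    ; +-homo = λ c d → ≐⇒≈ (λ i → ℤₚ.*-distribʳ-+ (one i) c d)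
    ; *-homo = λ c d → trans (≐⇒≈ (λ i → ℤₚ.*-assoc c d (one i))) (scale≈ c (scale d one))
    ; -‿homo = λ c → ≐⇒≈ (λ i → ≡.sym (ℤₚ.neg-distribˡ-* c (one i)))
    ; 0-homo = ≐⇒≈ (λ i → ≡.refl)
    ; 1-homo = ≐⇒≈ (λ i → ℤₚ.*-identityˡ (one i))
    }

  open FiniteSums ring constants using (:1; Σ<; ∏<; module Solver)

  geom-inverse : ∀ k → (one ⊕ (λ n → ℤ.- mono (suc k) n)) ⊛ geom (suc k) ≈ one
  geom-inverse k = begin
    (one ⊕ (λ n → ℤ.- m n)) ⊛ g          ≈⟨ solve 2 (λ m g → (:1 :- m) :* g := g :- m :* g) refl m g ⟩
    g ⊕ (λ n → ℤ.- (m ⊛ g) n)            ≈⟨ CommutativeRing.+-congʳ ring (≐⇒≈ (geom-unfold k)) ⟩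
    one ⊕ m ⊛ g ⊕ (λ n → ℤ.- (m ⊛ g) n)  ≈⟨ solve 2 (λ m g → :1 :+ m :* g :- m :* g := :1) refl m g ⟩
    one                                  ∎
    where
    open Solver
    m g : PS
    m = mono (suc k)
    g = geom (suc k)

  prodUpTo≡∏ : ∀ n f → prodUpTo n f ≡ ∏< n f
  prodUpTo≡∏ zero    f = ≡.refl
  prodUpTo≡∏ (suc n) f = ≡.cong (_⊛ f n) (prodUpTo≡∏ n f)

  prodUpTo-stable : ∀ f M → (∀ k → k ≥ M → f k ≈ one) → ∀ d → prodUpTo (d ℕ.+ M) f ≈ prodUpTo M f
  prodUpTo-stable f M f≈1 zero    = refl
  prodUpTo-stable f M f≈1 (suc d) = trans (*-cong (prodUpTo-stable f M f≈1 d) (f≈1 (d ℕ.+ M) (ℕₚ.m≤n+m M d))) (*-identityʳ _)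

  sumTo≡Σ : ∀ n F i → sumTo n (λ m → F m i) ≡ Σ< (suc n) F i
  sumTo≡Σ zero    F i = ≡.sym (ℤₚ.+-identityˡ _)
  sumTo≡Σ (suc n) F i = ≡.cong (ℤ._+ F (suc n) i) (sumTo≡Σ n F i)

-- Infinite sums and products modulo q^{N+1}.

sumTo-stable : ∀ n h → (∀ m → n < m → h m ≡ + 0) → ∀ d → sumTo (d ℕ.+ n) h ≡ sumTo n h
sumTo-stable n h h≡0 zero    = ≡.refl
sumTo-stable n h h≡0 (suc d) = ≡.trans (≡.cong₂ ℤ._+_ (sumTo-stable n h h≡0 d) (h≡0 (suc d ℕ.+ n) (s≤s (ℕₚ.m≤n+m n d)))) (ℤₚ.+-identityʳ _)

one⊕mono-order : ∀ k i → i < k → (one ⊕ mono k) i ≡ one i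
one⊕mono-order k i i<k = ≡.trans (≡.cong (λ a → one i ℤ.+ a) (mono-order k i i<k)) (ℤₚ.+-identityʳ _)

index : ∀ a k {i} → i ≤ k → i < a ℕ.+ 2 ℕ.+ 2 ℕ.* k
index a k i≤k = ℕₚ.≤-trans (s≤s i≤k) (ℕₚ.+-mono-≤ (ℕₚ.≤-trans (s≤s z≤n) (ℕₚ.m≤n+m 2 a)) (ℕₚ.m≤n*m k 2))

module Truncation (N : ℕ) where

  open Modulo N
  open CommutativeRing ring using (setoid; trans; reflexive; +-cong; +-congˡ; *-cong; *-congˡ; *-congʳ)
  open FiniteSums ring constants using (Σ<; ∏<; Σ-cong; ι; module WithQ)
  open WithQ mono (≐⇒≈ mono-0) (λ m n → ≐⇒≈ (mono-+ m n)) geom geom-inverse using (module Truncated)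
  -- K = N+1, since q^{N+1} is zero modulo itself.
  open Truncated (suc N) (mk (λ i i≤N → mono-order (suc N) i (s≤s i≤N))) using (A⁺; A⁻; S₁; S₂; summand; truncated-identity)
  open import Relation.Binary.Reasoning.Setoid setoid

  prodInf≈∏ : ∀ f → (∀ k i → i ≤ k → f k i ≡ one i) → prodInf f ≈ ∏< (suc N) f
  prodInf≈∏ f f≡1 = mk λ i i≤N → ≡.trans
    -- Coefficient i of `prodInf f` comes from a product of i+1 factors, a number that varies with
    -- i. Factors k > i are trivial only modulo q^{i+1}, so the comparison is made in that ring and
    -- read off at coefficient i.
    (≡.sym (at (Modulo.prodUpTo-stable i f (suc i) (λ k k>i → Modulo.mk (λ j j≤i → f≡1 k j (ℕₚ.≤-trans j≤i (ℕₚ.<⇒≤ k>i)))) (N ∸ i)) i ℕₚ.≤-refl))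
    (≡.cong (λ p → p i) (≡.trans (≡.cong (λ m → prodUpTo m f) (≡.trans (ℕₚ.+-suc (N ∸ i) i) (≡.cong suc (ℕₚ.m∸n+n≡m i≤N)))) (prodUpTo≡∏ (suc N) f)))
    where open Modulo._≈_

  sumInf1≈Σ : ∀ g → (∀ n i → i < n → g n i ≡ + 0) → sumInf1 g ≈ Σ< (suc N) (λ n → g (suc n))
  sumInf1≈Σ g g≡0 = mk λ i i≤N → ≡.trans
    (≡.sym (sumTo-stable i _ (λ m i<m → g≡0 (suc m) i (ℕₚ.m<n⇒m<1+n i<m)) (N ∸ i)))
    (≡.trans (≡.cong (λ m → sumTo m (λ n → g (suc n) i)) (ℕₚ.m∸n+n≡m i≤N)) (sumTo≡Σ N (λ n → g (suc n)) i))

  -- The form `a + 2` covers both uses definitionally: a = 0 for `A` and a = 2n for `sptTerm`.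
  negPochInf≈ : ∀ a → negPochInf (a ℕ.+ 2) 2 ≈ ∏< (suc N) (λ k → one ⊕ mono (a ℕ.+ 2 ℕ.+ 2 ℕ.* k))
  negPochInf≈ a = prodInf≈∏ _ (λ k i i≤k → one⊕mono-order _ i (index a k i≤k))

  invPochInf≈ : ∀ a → invPochInf (a ℕ.+ 2) 2 ≈ ∏< (suc N) (λ k → geom (a ℕ.+ 2 ℕ.+ 2 ℕ.* k))
  invPochInf≈ a = prodInf≈∏ _ (λ k i i≤k → geom-small _ i (index a k i≤k))

  A≈ : A ≈ A⁺ ⊛ A⁻
  A≈ = *-cong (negPochInf≈ 0) (invPochInf≈ 0)

  S1≈ : S1 ≈ S₁
  S1≈ = trans
    (sumInf1≈Σ _ (λ n i i<n → ≡.trans (≡.cong (+ n ℤ.*_) (⊛-order n (mono n) (geom n) (mono-order n) i i<n)) (ℤₚ.*-zeroʳ (+ n))))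
    (Σ-cong (suc N) (λ n → scale≈ (+ suc n) _))

  S2≈ : S2 ≈ S₂
  S2≈ = trans
    (sumInf1≈Σ _ (λ n i i<n → ≡.trans (≡.cong (sgn n ℤ.*_) (order n i i<n)) (ℤₚ.*-zeroʳ (sgn n))))
    (Σ-cong (suc N) (λ n → scale≈ (sgn (suc n)) _))
    where
    n≤2n[n+1] : ∀ n → n ≤ 2 ℕ.* n ℕ.* suc n
    n≤2n[n+1] n = ℕₚ.≤-trans (ℕₚ.m≤n*m n 2) (ℕₚ.m≤m*n (2 ℕ.* n) (suc n))
    order : ∀ n i → i < n → (mono (2 ℕ.* n ℕ.* suc n) ⊛ geom (2 ℕ.* n) ⊛ geom (2 ℕ.* n)) i ≡ + 0
    order n = ⊛-order n (mono (2 ℕ.* n ℕ.* suc n) ⊛ geom (2 ℕ.* n)) (geom (2 ℕ.* n))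
      (⊛-order n (mono (2 ℕ.* n ℕ.* suc n)) (geom (2 ℕ.* n)) (λ i i<n → mono-order _ i (ℕₚ.<-≤-trans i<n (n≤2n[n+1] n))))

  sptTerm≈ : ∀ n → sptTerm n ≈ summand n
  sptTerm≈ n = *-cong (*-cong (*-congʳ {geom n} (*-congʳ {geom n} (*-cong (*-congˡ {mono n} negPoch≈) (negPochInf≈ (2 ℕ.* n)))))
    invPoch≈) (invPochInf≈ (2 ℕ.* n))
    where
    negPoch≈ : negPoch (suc n) n ≈ ∏< n (λ k → one ⊕ mono (suc n ℕ.+ k))
    negPoch≈ = reflexive (prodUpTo≡∏ n _)
    invPoch≈ : invPoch (suc n) n ≈ ∏< n (λ k → geom (suc n ℕ.+ k))
    invPoch≈ = reflexive (prodUpTo≡∏ n _)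

  sptω≈RHS : Σ< (suc N) (λ n → sptTerm (suc n)) ≈ RHS
  sptω≈RHS = begin
    Σ< (suc N) (λ n → sptTerm (suc n))                ≈⟨ Σ-cong (suc N) (λ n → sptTerm≈ (suc n)) ⟩
    Σ< (suc N) (λ n → summand (suc n))                ≈⟨ truncated-identity ⟩
    A⁺ ⊛ A⁻ ⊛ S₁ ⊕ ι (+ 2) ⊛ (A⁺ ⊛ A⁻ ⊛ S₂)           ≈⟨ +-cong (*-cong A≈ S1≈) (*-congˡ {ι (+ 2)} (*-cong A≈ S2≈)) ⟨
    A ⊛ S1 ⊕ ι (+ 2) ⊛ (A ⊛ S2)                       ≈⟨ +-congˡ {A ⊛ S1} (scale≈ (+ 2) (A ⊛ S2)) ⟨
    RHS                                               ∎

theorem5p1 : (N : ℕ) → sptω N ≡ RHS N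
-- Coefficient N of `sptω` is by definition a sum over N+1 summands, exactly the length of the
-- truncated sum modulo q^{N+1}.
theorem5p1 N = ≡.trans (sumTo≡Σ N (λ n → sptTerm (suc n)) N) (at sptω≈RHS N ℕₚ.≤-refl)
  where
  open Modulo N
  open Truncation N
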